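{- For every BPPS instance, the LP relaxation of the arc-flow formulation $\mathrm{ILP}_{\mathrm{AF}}$ is at least as strong as the LP relaxation of the natural compact formulation $\mathrm{ILP}_{\mathrm N}$, i.e. $$\zeta(\mathrm{LP}_{\mathrm{AF}})\ \ge\ \zeta(\mathrm{LP}_{\mathrm N}).$$
   Context: **BPPS.** An instance of the Bin Packing Problem with Setups consists of: a bin capacity $d\in\mathbb Z_{\ge1}$; items $\mathcal I=\{1,\dots,n\}$ with weights $w_i\in\mathbb Z_{\ge1}$; classes $\mathcal C=\{1,\dots,m\}$ and a partition $\{\mathcal I_1,\dots,\mathcal I_m\}$ of $\mathcal I$ into (nonempty) classes; for each class $c$ a setup weight $s_c\in\mathbb Z_{\ge0}$ and a setup cost $f_c\in\mathbb Z_{\ge0}$; a bin cost $r\in\mathbb Z_{\ge1}$. It is assumed that $w_i+s_c\le d$ for all $c\in\mathcal C$, $i\in\mathcal I_c$, and that the items cannot all be packed in a single bin, i.e. $\sum_{i\in\mathcal I}w_i+\sum_{c\in\mathcal C}s_c>d$. For $S\subseteq\mathcal I$ let $\mathcal C(S)=\{c\in\mathcal C: S\cap\mathcal I_c\neq\emptyset\}$. A packing pattern is a subset $S\subseteq\mathcal I$ with $\sum_{i\in S}w_i+\sum_{c\in\mathcal C(S)}s_c\le d$. A feasible solution is a partition $\mathcal S$ of $\mathcal I$ into (nonempty) packing patterns (used bins); its cost is $r|\mathcal S|+\sum_{S\in\mathcal S}\sum_{c\in\mathcal C(S)}f_c$, to be minimized. **Natural formulation.** Let $k\in\mathbb Z_{\ge1}$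 be an upper bound on the number of bins used in any optimal BPPS solution and $\mathcal B=\{1,\dots,k\}$. $\mathrm{LP}_{\mathrm N}$ (the LP relaxation of $\mathrm{ILP}_{\mathrm N}$, which has the same constraints with binary variables) is: minimize $\sum_{b\in\mathcal B}\big(r z_b+\sum_{c\in\mathcal C}f_c y_{cb}\big)$ subject to $\sum_{b\in\mathcal B}x_{ib}=1$ ($i\in\mathcal I$); $\sum_{i\in\mathcal I}w_ix_{ib}+\sum_{c\in\mathcal C}s_cy_{cb}\le d\,z_b$ ($b\in\mathcal B$); $x_{ib}\le y_{cb}$ ($c\in\mathcal C$, $i\in\mathcal I_c$, $b\in\mathcal B$); all $x_{ib},y_{cb},z_b\in[0,1]$. Its optimal value is $\zeta(\mathrm{LP}_{\mathrm N})$. **DAG construction.** Vertices other than the sink $\tau$ are triples $(\ell,t,e)$ with load $\ell\in\{0,\dots,d\}$, stage $t\in\mathbb Z_{\ge0}$ and flag $e\in\{ -1,0,1\}$; only vertices generated by the following rules exist. The source is $\sigma=(0,0,-1)$. Each arc $a$ has a weight $\omega_a$ and a cost $\lambda_a$. Classes are processed in a fixed order, starting with $t_{\mathrm{prev}}=0$ (entry/exit layer $\{\sigma\}$). For class $c$, put $t_{\mathrm{exit}}=t_{\mathrm{prev}}+|\mathcal I_c|+2$, and: 1. from each vertex $(\ell,t_{\mathrm{prev}},-1)$ add a bypass arc (weight 0, cost 0) to $(\ell,t_{\mathrm{exit}},-1)$; 2. from each vertex $(\ell,t_{\mathrm{prev}},-1)$ with $\ell+s_c\le d$ add a setup arc of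 class $c$ (weight $s_c$, cost $f_c$) to $(\ell+s_c,t_{\mathrm{prev}}+1,0)$; 3. process the items of $\mathcal I_c$ in non-increasing order of weight, starting from stage $t=t_{\mathrm{prev}}+1$ and increasing $t$ by one after each item; for item $i$ and every vertex $(\ell,t,e)$ at the current stage $t$, add a bypass arc (weight 0, cost 0) to $(\ell,t+1,e)$ and, if $\ell+w_i\le d$, an item arc of item $i$ (weight $w_i$, cost 0) to $(\ell+w_i,t+1,1)$; 4. from each vertex $(\ell,t_{\mathrm{exit}}-1,1)$ add a bypass arc (weight 0, cost 0) to $(\ell,t_{\mathrm{exit}},-1)$; vertices $(\ell,t_{\mathrm{exit}}-1,0)$ receive no outgoing arc. Then set $t_{\mathrm{prev}}:=t_{\mathrm{exit}}$ and go to the next class. After the last class, each vertex of the final entry/exit layer with load $\ell\ge1$ gets a loss arc (weight 0, cost $r$) to $\tau$. Finally, all vertices from which $\tau$ is not reachable, and their incident arcs, are removed. **DAG compression.** Two steps. In Step 1, for each vertex $u$ let $\phi(u,\tau)$ be the maximum total weight of a path from $u$ to $\tau$; merge two vertices if and only if they have the same stage and the same value of $\phi(\cdot,\tau)$. In Step 2, on the resulting DAG, let $\phi(\sigma,u)$ be the maximum total weight of a path from $\sigma$ to $u$; merge two vertices if and only if they have the same stage and the same value of $\phi(\sigma,\cdot)$. The sink $\tau$ has its own stage (so it is not merged with any other vertex), and the flag $e$ plays no role in merging. Arcs are inherited by the merged vertices, keeping their type (setup arc of class $c$, item arc of item $i$, bypass, loss), weight and cost; parallel arcs of different types are kept distinct,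 and identical parallel arcs are identified. Let $\mathcal G=(\mathcal V,\mathcal A)$ be the resulting compressed DAG, and let $\mathcal A_{\mathcal I}(i)\subseteq\mathcal A$ be the set of item arcs of item $i$. **Arc-flow formulation.** $\mathrm{ILP}_{\mathrm{AF}}$ is: minimize $\sum_{a\in\mathcal A}\lambda_a\varphi_a$ subject to $\sum_{a\in\delta^-(v)}\varphi_a-\sum_{a\in\delta^+(v)}\varphi_a=0$ for all $v\in\mathcal V\setminus\{\sigma,\tau\}$; $\sum_{a\in\mathcal A_{\mathcal I}(i)}\varphi_a=1$ for all $i\in\mathcal I$; $\varphi_a\in\mathbb Z_{\ge0}$ for all $a\in\mathcal A$, where $\delta^-(v),\delta^+(v)$ are the sets of arcs entering and leaving $v$. $\mathrm{LP}_{\mathrm{AF}}$ is its LP relaxation (integrality replaced by $\varphi_a\ge0$) and $\zeta(\mathrm{LP}_{\mathrm{AF}})$ its optimal objective function value.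
   Formalization: The variables and optimal values of both linear programs range over the rationals instead of the reals; since all data are integers, both programs have the same optimal values over the rationals and the reals. -}

module Defs where

open import Data.Bool using (if_then_else_)
open import Data.Nat using (ℕ; zero; suc; _+_; _*_; _≤_; _<_; _≥_; _≤?_)
import Data.Nat.Properties as ℕ
open import Data.Nat.ListAction using (sum)
open import Data.Integer as ℤ using (ℤ; -1ℤ; 0ℤ; 1ℤ)
open import Data.Rational as ℚ using (ℚ; 0ℚ; 1ℚ)
open import Data.Fin using (Fin)
import Data.Fin.Properties as Fin
open import Data.Fin.Subset using (Subset; _∈_; _∩_; Nonempty; Empty)
open import Data.Fin.Subset.Properties using (_∈?_)
open import Data.List using (List; []; _∷_; _++_; [_]; map; foldr; concatMap; filter; length; allFin; deduplicate)
open import Data.List.Extrema.Nat using (max)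
import Data.List.Membership.Propositional as List
open import Data.List.Relation.Binary.Permutation.Propositional using (_↭_)
open import Data.List.Relation.Unary.All using (All)
open import Data.List.Relation.Unary.AllPairs using (AllPairs)
open import Data.List.Relation.Unary.Any using (Any)
open import Data.List.Relation.Unary.Linked using (Linked)
open import Data.Product using (_×_; _,_; proj₁; ∃)
import Data.Product.Properties as Product
open import Relation.Binary.Definitions using (DecidableEquality)
open import Relation.Binary.PropositionalEquality using (_≡_; _≢_; refl; cong)
open import Relation.Nullary using (Dec; yes; no; does)
open import Relation.Nullary.Decidable using (map′; _×-dec_)

∑ : {A : Set} → List A → (A → ℕ) → ℕ
∑ xs f = sum (map f xs)

∑ℚ : {A : Set} → List A → (A → ℚ) → ℚ
∑ℚ xs f = foldr ℚ._+_ 0ℚ (map f xs)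

fromℕ : ℕ → ℚ
fromℕ n = ℤ.+ n ℚ./ 1

------------------------------------------------------------------------
-- Bin packing with setups

record BPPS : Set where
  field
    n m         : ℕ
    d           : ℕ
    r           : ℕ
    weight      : Fin n → ℕ
    -- The partition of the items into classes: item i lies in class (class i).
    class       : Fin n → Fin m
    setupWeight : Fin m → ℕ
    setupCost   : Fin m → ℕ

  Item  = Fin n
  Class = Fin m

  field
    d≥1            : 1 ≤ d
    r≥1            : 1 ≤ r
    weight≥1       : ∀ i → 1 ≤ weight i
    class-nonempty : ∀ c → ∃ λ i → class i ≡ c
    item-fits      : ∀ i → weight i + setupWeight (class i) ≤ d
    not-single-bin : d < ∑ (allFin n) weight + ∑ (allFin m) setupWeight

  itemsOf : Class → List Item
  itemsOf c = filter (λ i → class i Fin.≟ c) (allFin n)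

module Packing (I : BPPS) where
  open BPPS I

  members : Subset n → List Item
  members S = filter (_∈? S) (allFin n)

  classes : Subset n → List Class
  classes S = filter (λ c → Fin.any? (λ i → (i ∈? S) ×-dec (class i Fin.≟ c))) (allFin m)

  IsPattern : Subset n → Set
  IsPattern S = ∑ (members S) weight + ∑ (classes S) setupWeight ≤ d

  -- Bins are listed in an arbitrary order; pairwise disjointness and
  -- nonemptiness exclude repetitions.
  record Solution : Set where
    field
      bins     : List (Subset n)
      nonempty : All Nonempty bins
      patterns : All IsPattern bins
      disjoint : AllPairs (λ S T → Empty (S ∩ T)) bins
      cover    : ∀ i → Any (i ∈_) bins

  open Solution public

  cost : Solution → ℕ
  cost 𝒮 = r * length (bins 𝒮) + ∑ (bins 𝒮) (λ S → ∑ (classes S) setupCost)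

  IsOptimal : Solution → Set
  IsOptimal 𝒮 = ∀ 𝒯 → cost 𝒮 ≤ cost 𝒯

  BoundsOptimalBins : ℕ → Set
  BoundsOptimalBins k = ∀ 𝒮 → IsOptimal 𝒮 → length (bins 𝒮) ≤ k

------------------------------------------------------------------------
-- Linear programs, with rational variables; all programs below have
-- integer data, so their optimal values over ℚ and over the reals agree.

record LP : Set₁ where
  field
    Variables : Set
    Feasible  : Variables → Set
    objective : Variables → ℚ

IsOptimalValue : LP → ℚ → Set
IsOptimalValue P ζ =
  (∃ λ v → Feasible v × objective v ≡ ζ) × (∀ v → Feasible v → ζ ℚ.≤ objective v)
  where open LP P

------------------------------------------------------------------------
-- The natural formulation

module Natural (I : BPPS) (k : ℕ) where
  open BPPS I

  Bin = Fin k

  record Vars : Set where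
    field
      x : Item  → Bin → ℚ
      y : Class → Bin → ℚ
      z : Bin → ℚ

  InUnitInterval : ℚ → Set
  InUnitInterval q = 0ℚ ℚ.≤ q × q ℚ.≤ 1ℚ

  record Feasible (v : Vars) : Set where
    open Vars v
    field
      assignment : ∀ i → ∑ℚ (allFin k) (λ b → x i b) ≡ 1ℚ
      capacity   : ∀ b →
        ∑ℚ (allFin n) (λ i → fromℕ (weight i) ℚ.* x i b)
          ℚ.+ ∑ℚ (allFin m) (λ c → fromℕ (setupWeight c) ℚ.* y c b)
        ℚ.≤ fromℕ d ℚ.* z b
      linking    : ∀ c i b → class i ≡ c → x i b ℚ.≤ y c b
      x-bounds   : ∀ i b → InUnitInterval (x i b)
      y-bounds   : ∀ c b → InUnitInterval (y c b)
      z-bounds   : ∀ b → InUnitInterval (z b)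

  objective : Vars → ℚ
  objective v = ∑ℚ (allFin k) λ b →
      fromℕ r ℚ.* z b ℚ.+ ∑ℚ (allFin m) (λ c → fromℕ (setupCost c) ℚ.* y c b)
    where open Vars v

LP-N : BPPS → ℕ → LP
LP-N I k = record { Variables = Vars; Feasible = Feasible; objective = objective }
  where open Natural I k

------------------------------------------------------------------------
-- The compressed DAG

-- The order in which the DAG construction processes the classes and the
-- items of each class; ties between equal weights are broken arbitrarily.
record ProcessingOrder (I : BPPS) : Set where
  open BPPS I
  field
    classOrder : List Class
    classes-↭  : classOrder ↭ allFin m
    itemOrder  : Class → List Item
    items-↭    : ∀ c → itemOrder c ↭ itemsOf c
    sorted     : ∀ c → Linked (λ i j → weight i ≥ weight j) (itemOrder c)

module DAG (I : BPPS) where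
  open BPPS I

  data ArcType : Set where
    setup  : Class → ArcType
    item   : Item → ArcType
    bypass : ArcType
    loss   : ArcType

  ω : ArcType → ℕ
  ω (setup c) = setupWeight c
  ω (item i)  = weight i
  ω bypass    = 0
  ω loss      = 0

  arcCost : ArcType → ℕ
  arcCost (setup c) = setupCost c
  arcCost (item i)  = 0
  arcCost bypass    = 0
  arcCost loss      = r

  _≟ᵗ_ : DecidableEquality ArcType
  setup c ≟ᵗ setup c′ = map′ (cong setup) (λ { refl → refl }) (c Fin.≟ c′)
  setup _ ≟ᵗ item _   = no λ ()
  setup _ ≟ᵗ bypass   = no λ ()
  setup _ ≟ᵗ loss     = no λ ()
  item _  ≟ᵗ setup _  = no λ ()
  item i  ≟ᵗ item i′  = map′ (cong item) (λ { refl → refl }) (i Fin.≟ i′)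
  item _  ≟ᵗ bypass   = no λ ()
  item _  ≟ᵗ loss     = no λ ()
  bypass  ≟ᵗ setup _  = no λ ()
  bypass  ≟ᵗ item _   = no λ ()
  bypass  ≟ᵗ bypass   = yes refl
  bypass  ≟ᵗ loss     = no λ ()
  loss    ≟ᵗ setup _  = no λ ()
  loss    ≟ᵗ item _   = no λ ()
  loss    ≟ᵗ bypass   = no λ ()
  loss    ≟ᵗ loss     = yes refl

  record Arc (V : Set) : Set where
    constructor arc
    field
      tail : V
      type : ArcType
      head : V

  open Arc public

  arc-≟ : {V : Set} → DecidableEquality V → DecidableEquality (Arc V)
  arc-≟ _≟_ (arc u t v) (arc u′ t′ v′) =
    map′ (λ { (refl , refl , refl) → refl }) (λ { refl → refl , refl , refl })
         ((u ≟ u′) ×-dec ((t ≟ᵗ t′) ×-dec (v ≟ v′)))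

  -- In the graphs considered here every vertex other than the source and the
  -- sink is an endpoint of an arc, so the vertex set is recovered from the
  -- arcs, and every arc strictly increases the stage.
  record Graph : Set₁ where
    field
      Vertex : Set
      _≟_    : DecidableEquality Vertex
      stage  : Vertex → ℕ
      source : Vertex
      sink   : Vertex
      arcs   : List (Arc Vertex)

    vertices : List Vertex
    vertices = source ∷ sink ∷ concatMap (λ a → tail a ∷ head a ∷ []) arcs

    arcs⁻ arcs⁺ : Vertex → List (Arc Vertex)
    arcs⁻ v = filter (λ a → head a ≟ v) arcs
    arcs⁺ v = filter (λ a → tail a ≟ v) arcs

    -- The total weights of the paths from u to v with at most k arcs.
    weightsWithin : ℕ → Vertex → Vertex → List ℕ
    weightsWithin k u v = (if does (u ≟ v) then [ 0 ] else []) ++ longer k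
      where
      longer : ℕ → List ℕ
      longer zero    = []
      longer (suc k) =
        concatMap (λ a → map (ω (type a) +_) (weightsWithin k (head a) v)) (arcs⁺ u)

    -- The total weights of all paths from u to v: as stages increase along
    -- arcs, no path has more than (stage sink) arcs.
    pathWeights : Vertex → Vertex → List ℕ
    pathWeights = weightsWithin (stage sink)

    Reaches : Vertex → Vertex → Set
    Reaches u v = 1 ≤ length (pathWeights u v)

    reaches? : ∀ u v → Dec (Reaches u v)
    reaches? u v = 1 ≤? length (pathWeights u v)

    -- The maximum weight of a path from u to v, if there is one.
    φ : Vertex → Vertex → ℕ
    φ u v = max 0 (pathWeights u v)

  -- A merged vertex is represented by the stage and the label shared by the
  -- vertices merged into it.
  merge : (G : Graph) → (Graph.Vertex G → ℕ) → Graph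
  merge G label = record
    { Vertex = ℕ × ℕ
    ; _≟_    = ≟²
    ; stage  = proj₁
    ; source = key source
    ; sink   = key sink
    ; arcs   = deduplicate (arc-≟ ≟²) (map (λ (arc u t v) → arc (key u) t (key v)) arcs)
    }
    where
    open Graph G
    ≟² : DecidableEquality (ℕ × ℕ)
    ≟² = Product.≡-dec ℕ._≟_ ℕ._≟_
    key : Vertex → ℕ × ℕ
    key u = stage u , label u

  trim : Graph → Graph
  trim G = record
    { Vertex = Vertex
    ; _≟_    = _≟_
    ; stage  = stage
    ; source = source
    ; sink   = sink
    ; arcs   = filter (λ a → reaches? (tail a) sink ×-dec reaches? (head a) sink) arcs
    }
    where open Graph G

  compress₁ compress₂ compress : Graph → Graph
  compress₁ G = merge G (λ u → Graph.φ G u (Graph.sink G))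
  compress₂ G = merge G (λ u → Graph.φ G (Graph.source G) u)
  compress G  = compress₂ (compress₁ G)

  module Construction (O : ProcessingOrder I) where
    open ProcessingOrder O

    data RawVertex : Set where
      ⟨_,_,_⟩ : (load stage : ℕ) (flag : ℤ) → RawVertex
      τ       : RawVertex

    _≟ʳ_ : DecidableEquality RawVertex
    ⟨ ℓ , t , e ⟩ ≟ʳ ⟨ ℓ′ , t′ , e′ ⟩ =
      map′ (λ { (refl , refl , refl) → refl }) (λ { refl → refl , refl , refl })
           ((ℓ ℕ.≟ ℓ′) ×-dec ((t ℕ.≟ t′) ×-dec (e ℤ.≟ e′)))
    ⟨ _ , _ , _ ⟩ ≟ʳ τ             = no λ ()
    τ             ≟ʳ ⟨ _ , _ , _ ⟩ = no λ ()
    τ             ≟ʳ τ             = yes refl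

    RawArc : Set
    RawArc = Arc RawVertex

    -- The vertices of a layer, all of one stage, are given by load and flag;
    -- in an entry/exit layer, where all flags are -1, by load alone.
    Layer EntryLayer : Set
    Layer      = List (ℕ × ℤ)
    EntryLayer = List ℕ

    dedupLayer : Layer → Layer
    dedupLayer = deduplicate (Product.≡-dec ℕ._≟_ ℤ._≟_)

    fitting : ℕ → Layer → Layer
    fitting w = filter (λ (ℓ , _) → ℓ + w ≤? d)

    itemArcs : Item → ℕ → Layer → List RawArc
    itemArcs i t L =
         map (λ (ℓ , e) → arc ⟨ ℓ , t , e ⟩ bypass ⟨ ℓ , suc t , e ⟩) L
      ++ map (λ (ℓ , e) → arc ⟨ ℓ , t , e ⟩ (item i) ⟨ ℓ + weight i , suc t , 1ℤ ⟩)
             (fitting (weight i) L)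

    afterItem : Item → Layer → Layer
    afterItem i L =
      dedupLayer (L ++ map (λ (ℓ , _) → ℓ + weight i , 1ℤ) (fitting (weight i) L))

    itemsArcs : List Item → ℕ → Layer → List RawArc
    itemsArcs []       t L = []
    itemsArcs (i ∷ is) t L = itemArcs i t L ++ itemsArcs is (suc t) (afterItem i L)

    afterItems : List Item → Layer → Layer
    afterItems []       L = L
    afterItems (i ∷ is) L = afterItems is (afterItem i L)

    module _ (c : Class) where

      canSetup : EntryLayer → EntryLayer
      canSetup = filter (λ ℓ → ℓ + setupWeight c ≤? d)

      afterSetup : EntryLayer → Layer
      afterSetup E = dedupLayer (map (λ ℓ → ℓ + setupWeight c , 0ℤ) (canSetup E))

      packed : EntryLayer → EntryLayer
      packed E = map proj₁ (filter (λ (_ , e) → e ℤ.≟ 1ℤ)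
                                   (afterItems (itemOrder c) (afterSetup E)))

      exitStage : ℕ → ℕ
      exitStage t = t + length (itemOrder c) + 2

      exitLayer : EntryLayer → EntryLayer
      exitLayer E = deduplicate ℕ._≟_ (E ++ packed E)

      classArcs : ℕ → EntryLayer → List RawArc
      classArcs t E =
           map (λ ℓ → arc ⟨ ℓ , t , -1ℤ ⟩ bypass ⟨ ℓ , exitStage t , -1ℤ ⟩) E
        ++ map (λ ℓ → arc ⟨ ℓ , t , -1ℤ ⟩ (setup c) ⟨ ℓ + setupWeight c , t + 1 , 0ℤ ⟩)
               (canSetup E)
        ++ itemsArcs (itemOrder c) (t + 1) (afterSetup E)
        ++ map (λ ℓ → arc ⟨ ℓ , t + length (itemOrder c) + 1 , 1ℤ ⟩ bypass
                          ⟨ ℓ , exitStage t , -1ℤ ⟩)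
               (packed E)

    lossArcs : ℕ → EntryLayer → List RawArc
    lossArcs t E = map (λ ℓ → arc ⟨ ℓ , t , -1ℤ ⟩ loss τ) (filter (1 ≤?_) E)

    allArcs : List Class → ℕ → EntryLayer → List RawArc
    allArcs []       t E = lossArcs t E
    allArcs (c ∷ cs) t E = classArcs c t E ++ allArcs cs (exitStage c t) (exitLayer c E)

    finalStage : List Class → ℕ → ℕ
    finalStage []       t = t
    finalStage (c ∷ cs) t = finalStage cs (exitStage c t)

    rawStage : RawVertex → ℕ
    rawStage ⟨ _ , t , _ ⟩ = t
    rawStage τ             = suc (finalStage classOrder 0)

    rawDAG : Graph
    rawDAG = record
      { Vertex = RawVertex
      ; _≟_    = _≟ʳ_
      ; stage  = rawStage
      ; source = ⟨ 0 , 0 , -1ℤ ⟩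
      ; sink   = τ
      ; arcs   = deduplicate (arc-≟ _≟ʳ_) (allArcs classOrder 0 [ 0 ])
      }

    compressedDAG : Graph
    compressedDAG = compress (trim rawDAG)

------------------------------------------------------------------------
-- The arc-flow formulation

module ArcFlow (I : BPPS) (O : ProcessingOrder I) where
  open BPPS I
  open DAG I
  open Graph (Construction.compressedDAG O)

  arcsOfItem : Item → List (Arc Vertex)
  arcsOfItem i = filter (λ a → type a ≟ᵗ item i) arcs

  -- Only the values on members of arcs matter.
  Flow : Set
  Flow = Arc Vertex → ℚ

  record Feasible (f : Flow) : Set where
    field
      conservation : ∀ v → v List.∈ vertices → v ≢ source → v ≢ sink →
        ∑ℚ (arcs⁻ v) f ℚ.- ∑ℚ (arcs⁺ v) f ≡ 0ℚ
      packing      : ∀ i → ∑ℚ (arcsOfItem i) f ≡ 1ℚ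
      nonnegative  : ∀ a → a List.∈ arcs → 0ℚ ℚ.≤ f a

  objective : Flow → ℚ
  objective f = ∑ℚ arcs (λ a → fromℕ (arcCost (type a)) ℚ.* f a)

LP-AF : (I : BPPS) → ProcessingOrder I → LP
LP-AF I O = record { Variables = Flow; Feasible = Feasible; objective = objective }
  where open ArcFlow I O

{-# OPTIONS --safe #-}
-- Write W for the sum of all item weights and all setup weights, and F for the
-- sum of all setup costs.  Spreading every item and every class uniformly over
-- the k bins gives a solution of LP-N of cost r W / d + F; it satisfies z ≤ 1
-- because feasibility of LP-N forces W ≤ d k.  Conversely, r W / d + F bounds
-- the cost of a flow from below by two potential arguments.  First, the flow
-- through the item arcs of an item of class c, which is 1, must have crossed a
-- setup arc of c.  Second, the label of a compressed vertex, its longest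
-- distance from the source, grows by at least the weight along every arc and
-- is at most d, so the total weight carried by the flow is at most d times the
-- flow through the loss arcs.
module Submission where

open import Defs
open import Data.Bool using (if_then_else_; true; false)
import Data.Fin.Properties as Fin
open import Data.Integer as ℤ using (ℤ; -1ℤ; 0ℤ; 1ℤ)
open import Data.List using (List; []; _∷_; [_]; _++_; filter; map; length; deduplicate; allFin)
open import Data.List.Extrema.Nat using (max≤v⁺; xs≤max)
open import Data.List.Membership.Propositional using (_∈_; find; lose)
open import Data.List.Membership.Propositional.Properties
open import Data.List.Properties using (++-assoc; length-++; length-tabulate; ∷-injectiveˡ; ∷-injectiveʳ)
open import Data.List.Relation.Binary.Permutation.Propositional using (↭-sym; ↭⇒↭ₛ)
open import Data.List.Relation.Binary.Permutation.Propositional.Properties using (∈-resp-↭)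
import Data.List.Relation.Binary.Permutation.Setoid.Properties as ↭ₛ
open import Data.List.Relation.Unary.All as All using ()
open import Data.List.Relation.Unary.AllPairs using (_∷_)
open import Data.List.Relation.Unary.Any using (here; there)
import Data.List.Relation.Unary.Unique.DecPropositional.Properties as UniqueDec
open import Data.List.Relation.Unary.Unique.Propositional using (Unique)
open import Data.List.Relation.Unary.Unique.Propositional.Properties using (allFin⁺; filter⁺)
open import Data.Nat as ℕ using (ℕ; zero; suc; z≤n; s≤s)
import Data.Nat.Properties as ℕ
open import Data.Product using (_×_; _,_; ∃; proj₁; proj₂)
import Data.Product.Properties as Product
open import Data.Rational as ℚ using (ℚ; 0ℚ; 1ℚ)
import Data.Rational.Properties as ℚ
open import Data.Rational.Solver using (module +-*-Solver)
open import Data.Sum using (_⊎_; inj₁; inj₂; [_,_]′)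
open import Function using (_∘_)
open import Relation.Binary.Definitions using (DecidableEquality)
open import Relation.Binary.PropositionalEquality
  using (_≡_; _≢_; refl; sym; trans; cong; cong₂; subst; subst₂; setoid; module ≡-Reasoning)
open import Relation.Nullary using (¬_; Dec; yes; no; does; contradiction)
open import Relation.Nullary.Decidable using (dec-true; dec-false; _×-dec_)
open import Relation.Unary using (Pred; Decidable)

-- Conservation is imposed only away from the source and the sink, so a potential gives an identity
-- between the two ends of the arcs only if it vanishes at both. Each of the two arguments is then
-- an inequality on single arcs, multiplied by the flow and summed. The obstacle is compression: a
-- merged vertex stands for several loads and flags, and merging may create paths that lift to no
-- raw path. What survives on an arc is its type and the stages of its ends, which is all that the
-- first potential uses. Loads do not survive, so the bound `d` on the labels is obtained
-- indirectly. Along every arc of the once-merged DAG the first-step labels drop by at least the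
-- weight, hence the weight of any path from its source, new ones included, is at most the label of
-- that source, the longest source-sink distance. This distance is at most `d` because the free
-- space of a bin drops in the same way in the raw DAG. As `φ` enumerates paths of bounded length
-- and defaults to 0, these steps also require that stages increase and that the relevant paths from
-- the source and to the sink exist.

-- Finite sums and indicators over the rationals.

module RationalSums where
  open import Data.Rational hiding (_≟_)
  open import Data.Rational.Properties hiding (_≟_)
  import Algebra.Properties.CommutativeSemigroup as CommutativeSemigroup
  open import Algebra.Bundles using (CommutativeMonoid)
  import Data.Integer.Properties as ℤ
  import Data.Rational.Unnormalised as ℚᵘ
  import Data.Rational.Unnormalised.Properties as ℚᵘ

  open CommutativeSemigroup (CommutativeMonoid.commutativeSemigroup +-0-commutativeMonoid) using (interchange)

  toℚᵘ-fromℕ : ∀ n → toℚᵘ (fromℕ n) ℚᵘ.≃ ℚᵘ.mkℚᵘ (ℤ.+ n) 0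
  toℚᵘ-fromℕ n = toℚᵘ-fromℚᵘ (ℚᵘ.mkℚᵘ (ℤ.+ n) 0)

  fromℕ-homo-+ : ∀ a b → fromℕ (a ℕ.+ b) ≡ fromℕ a + fromℕ b
  fromℕ-homo-+ a b = toℚᵘ-injective (begin
    toℚᵘ (fromℕ (a ℕ.+ b))                        ≈⟨ toℚᵘ-fromℕ (a ℕ.+ b) ⟩
    ℚᵘ.mkℚᵘ (ℤ.+ (a ℕ.+ b)) 0                     ≈⟨ ℚᵘ.*≡* (cong (ℤ._* ℤ.1ℤ) (sym (cong₂ ℤ._+_ (ℤ.*-identityʳ (ℤ.+ a)) (ℤ.*-identityʳ (ℤ.+ b))))) ⟩
    ℚᵘ.mkℚᵘ (ℤ.+ a) 0 ℚᵘ.+ ℚᵘ.mkℚᵘ (ℤ.+ b) 0      ≈⟨ ℚᵘ.+-cong (toℚᵘ-fromℕ a) (toℚᵘ-fromℕ b) ⟨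
    toℚᵘ (fromℕ a) ℚᵘ.+ toℚᵘ (fromℕ b)            ≈⟨ toℚᵘ-homo-+ (fromℕ a) (fromℕ b) ⟨
    toℚᵘ (fromℕ a + fromℕ b)                      ∎)
    where open ℚᵘ.≃-Reasoning

  fromℕ-mono-≤ : ∀ {a b} → a ℕ.≤ b → fromℕ a ≤ fromℕ b
  fromℕ-mono-≤ {a} {b} a≤b = toℚᵘ-cancel-≤ (begin
    toℚᵘ (fromℕ a)      ≃⟨ toℚᵘ-fromℕ a ⟩
    ℚᵘ.mkℚᵘ (ℤ.+ a) 0   ≤⟨ ℚᵘ.*≤* (ℤ.*-monoʳ-≤-nonNeg ℤ.1ℤ (ℤ.+≤+ a≤b)) ⟩
    ℚᵘ.mkℚᵘ (ℤ.+ b) 0   ≃⟨ toℚᵘ-fromℕ b ⟨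
    toℚᵘ (fromℕ b)      ∎)
    where open ℚᵘ.≤-Reasoning

  0≤fromℕ : ∀ n → 0ℚ ≤ fromℕ n
  0≤fromℕ n = fromℕ-mono-≤ {0} {n} ℕ.z≤n

  *-monoˡ-≤-0≤ : ∀ {p q r} → 0ℚ ≤ r → p ≤ q → r * p ≤ r * q
  *-monoˡ-≤-0≤ {r = r} 0≤r = *-monoˡ-≤-nonNeg r {{nonNegative 0≤r}}

  *-monoʳ-≤-0≤ : ∀ {p q r} → 0ℚ ≤ r → p ≤ q → p * r ≤ q * r
  *-monoʳ-≤-0≤ {r = r} 0≤r = *-monoʳ-≤-nonNeg r {{nonNegative 0≤r}}

  +-cancelˡ-≤ : ∀ p {q r} → p + q ≤ p + r → q ≤ r
  +-cancelˡ-≤ p {q} {r} le = subst₂ _≤_ (strip q) (strip r) (+-monoʳ-≤ (- p) le)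
    where
    strip : ∀ s → - p + (p + s) ≡ s
    strip s = trans (sym (+-assoc (- p) p s)) (trans (cong (_+ s) (+-inverseˡ p)) (+-identityˡ s))

  p-q≡0⇒p≡q : ∀ p q → p - q ≡ 0ℚ → p ≡ q
  p-q≡0⇒p≡q p q eq = begin
    p              ≡⟨ sym (+-identityʳ p) ⟩
    p + 0ℚ         ≡⟨ cong (p +_) (sym (+-inverseˡ q)) ⟩
    p + (- q + q)  ≡⟨ sym (+-assoc p (- q) q) ⟩
    p - q + q      ≡⟨ cong (_+ q) eq ⟩
    0ℚ + q         ≡⟨ +-identityˡ q ⟩
    q              ∎
    where open ≡-Reasoning

  private variable
    A B : Set

  ∑ℚ-cong : ∀ (xs : List A) {f g : A → ℚ} → (∀ {x} → x ∈ xs → f x ≡ g x) → ∑ℚ xs f ≡ ∑ℚ xs g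
  ∑ℚ-cong []       eq = refl
  ∑ℚ-cong (x ∷ xs) eq = cong₂ _+_ (eq (here refl)) (∑ℚ-cong xs (λ x∈ → eq (there x∈)))

  ∑ℚ-mono : ∀ (xs : List A) {f g : A → ℚ} → (∀ {x} → x ∈ xs → f x ≤ g x) → ∑ℚ xs f ≤ ∑ℚ xs g
  ∑ℚ-mono []       le = ≤-refl
  ∑ℚ-mono (x ∷ xs) le = +-mono-≤ (le (here refl)) (∑ℚ-mono xs (λ x∈ → le (there x∈)))

  ∑ℚ-0 : ∀ (xs : List A) → ∑ℚ xs (λ _ → 0ℚ) ≡ 0ℚ
  ∑ℚ-0 []       = refl
  ∑ℚ-0 (x ∷ xs) = trans (+-identityˡ _) (∑ℚ-0 xs)

  ∑ℚ-+ : ∀ (xs : List A) (f g : A → ℚ) → ∑ℚ xs (λ x → f x + g x) ≡ ∑ℚ xs f + ∑ℚ xs g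
  ∑ℚ-+ []       f g = refl
  ∑ℚ-+ (x ∷ xs) f g = trans (cong (f x + g x +_) (∑ℚ-+ xs f g)) (interchange (f x) (g x) _ _)

  ∑ℚ-*ˡ : ∀ q (xs : List A) (f : A → ℚ) → ∑ℚ xs (λ x → q * f x) ≡ q * ∑ℚ xs f
  ∑ℚ-*ˡ q []       f = sym (*-zeroʳ q)
  ∑ℚ-*ˡ q (x ∷ xs) f = trans (cong (q * f x +_) (∑ℚ-*ˡ q xs f)) (sym (*-distribˡ-+ q (f x) _))

  ∑ℚ-*ʳ : ∀ q (xs : List A) (f : A → ℚ) → ∑ℚ xs (λ x → f x * q) ≡ ∑ℚ xs f * q
  ∑ℚ-*ʳ q []       f = sym (*-zeroˡ q)
  ∑ℚ-*ʳ q (x ∷ xs) f = trans (cong (f x * q +_) (∑ℚ-*ʳ q xs f)) (sym (*-distribʳ-+ q (f x) _))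

  ∑ℚ-swap : ∀ (xs : List A) (ys : List B) (f : A → B → ℚ) →
    ∑ℚ xs (λ x → ∑ℚ ys (f x)) ≡ ∑ℚ ys (λ y → ∑ℚ xs (λ x → f x y))
  ∑ℚ-swap []       ys f = sym (∑ℚ-0 ys)
  ∑ℚ-swap (x ∷ xs) ys f =
    trans (cong (∑ℚ ys (f x) +_) (∑ℚ-swap xs ys f)) (sym (∑ℚ-+ ys (f x) _))

  ∑ℚ-const : ∀ (xs : List A) q → ∑ℚ xs (λ _ → q) ≡ fromℕ (length xs) * q
  ∑ℚ-const []       q = sym (*-zeroˡ q)
  ∑ℚ-const (x ∷ xs) q = begin
    q + ∑ℚ xs (λ _ → q)                ≡⟨ cong₂ _+_ (sym (*-identityˡ q)) (∑ℚ-const xs q) ⟩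
    1ℚ * q + fromℕ (length xs) * q     ≡⟨ sym (*-distribʳ-+ q 1ℚ (fromℕ (length xs))) ⟩
    (1ℚ + fromℕ (length xs)) * q       ≡⟨ cong (_* q) (sym (fromℕ-homo-+ 1 (length xs))) ⟩
    fromℕ (suc (length xs)) * q        ∎
    where open ≡-Reasoning

  ∑ℚ-const-allFin : ∀ k q → ∑ℚ (allFin k) (λ _ → q) ≡ fromℕ k * q
  ∑ℚ-const-allFin k q =
    trans (∑ℚ-const (allFin k) q) (cong (λ l → fromℕ l * q) (length-tabulate {n = k} (λ i → i)))

  𝟙 : ∀ {P : Set} → Dec P → ℚ
  𝟙 P? = if does P? then 1ℚ else 0ℚ

  ∑ℚ-filter : ∀ {P : Pred A _} (P? : Decidable P) xs (f : A → ℚ) →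
    ∑ℚ (filter P? xs) f ≡ ∑ℚ xs (λ x → 𝟙 (P? x) * f x)
  ∑ℚ-filter P? []       f = refl
  ∑ℚ-filter P? (x ∷ xs) f with does (P? x)
  ... | true  = cong₂ _+_ (sym (*-identityˡ (f x))) (∑ℚ-filter P? xs f)
  ... | false = trans (∑ℚ-filter P? xs f)
                      (sym (trans (cong (_+ _) (*-zeroˡ (f x))) (+-identityˡ _)))

  module _ (_≟_ : DecidableEquality A) where

    private
      ∑ℚ-𝟙-∉ : ∀ {x} xs (g : A → ℚ) → (∀ {y} → y ∈ xs → x ≢ y) →
        ∑ℚ xs (λ y → g y * 𝟙 (x ≟ y)) ≡ 0ℚ
      ∑ℚ-𝟙-∉ {x} xs g x∉ = trans
        (∑ℚ-cong xs λ {y} y∈ →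
          trans (cong (λ b → g y * (if b then 1ℚ else 0ℚ)) (dec-false (x ≟ y) (x∉ y∈))) (*-zeroʳ (g y)))
        (∑ℚ-0 xs)

    -- Exactly one summand survives: membership gives at least one, uniqueness at most one.
    ∑ℚ-𝟙 : ∀ {x xs} (g : A → ℚ) → Unique xs → x ∈ xs → ∑ℚ xs (λ y → g y * 𝟙 (x ≟ y)) ≡ g x
    ∑ℚ-𝟙 {x} {_ ∷ xs} g (x∉xs ∷ _) (here refl) = begin
      g x * 𝟙 (x ≟ x) + ∑ℚ xs _
        ≡⟨ cong₂ _+_ (cong (λ b → g x * (if b then 1ℚ else 0ℚ)) (dec-true (x ≟ x) refl)) (∑ℚ-𝟙-∉ xs g (All.lookup x∉xs)) ⟩
      g x * 1ℚ + 0ℚ ≡⟨ +-identityʳ _ ⟩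
      g x * 1ℚ      ≡⟨ *-identityʳ (g x) ⟩
      g x           ∎
      where open ≡-Reasoning
    ∑ℚ-𝟙 {x} {y ∷ xs} g (y∉xs ∷ uniq) (there x∈) = begin
      g y * 𝟙 (x ≟ y) + ∑ℚ xs _
        ≡⟨ cong₂ _+_ (cong (λ b → g y * (if b then 1ℚ else 0ℚ)) (dec-false (x ≟ y) λ x≡y → All.lookup y∉xs x∈ (sym x≡y))) (∑ℚ-𝟙 g uniq x∈) ⟩
      g y * 0ℚ + g x ≡⟨ cong (_+ g x) (*-zeroʳ (g y)) ⟩
      0ℚ + g x       ≡⟨ +-identityˡ (g x) ⟩
      g x            ∎
      where open ≡-Reasoning

  0≤* : ∀ {p q} → 0ℚ ≤ p → 0ℚ ≤ q → 0ℚ ≤ p * q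
  0≤* {p} {q} 0≤p 0≤q = subst (_≤ p * q) (*-zeroʳ p) (*-monoˡ-≤-0≤ 0≤p 0≤q)

  0≤∑ℚ : ∀ (xs : List A) {f : A → ℚ} → (∀ x → 0ℚ ≤ f x) → 0ℚ ≤ ∑ℚ xs f
  0≤∑ℚ xs {f} 0≤f = subst (_≤ ∑ℚ xs f) (∑ℚ-0 xs) (∑ℚ-mono xs λ {x} _ → 0≤f x)

  p≤p+q : ∀ {p q} → 0ℚ ≤ q → p ≤ p + q
  p≤p+q {p} {q} 0≤q = subst (_≤ p + q) (+-identityʳ p) (+-monoʳ-≤ p 0≤q)

  p≤q+p : ∀ {p q} → 0ℚ ≤ q → p ≤ q + p
  p≤q+p {p} {q} 0≤q = subst (_≤ q + p) (+-identityˡ p) (+-monoˡ-≤ p 0≤q)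

  fromℕ-inverse : ∀ {n} → 1 ℕ.≤ n → ∃ λ q → 0ℚ ≤ q × fromℕ n * q ≡ 1ℚ
  fromℕ-inverse {n} 1≤n = 1/ fromℕ n , nonNegative⁻¹ (1/ fromℕ n) , *-inverseʳ (fromℕ n)
    where
    instance
      n-positive : Positive (fromℕ n)
      n-positive = positive (<-≤-trans {0ℚ} {1ℚ} {fromℕ n} (positive⁻¹ 1ℚ) (fromℕ-mono-≤ {1} {n} 1≤n))
      n-nonZero = pos⇒nonZero (fromℕ n)
      1/n-nonNeg = pos⇒nonNeg (1/ fromℕ n) {{1/pos⇒pos (fromℕ n)}}

  𝟙-true : ∀ {P : Set} (P? : Dec P) → P → 𝟙 P? ≡ 1ℚ
  𝟙-true P? p = cong (if_then 1ℚ else 0ℚ) (dec-true P? p)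

  𝟙-≤1 : ∀ {P : Set} (P? : Dec P) → 𝟙 P? ≤ 1ℚ
  𝟙-≤1 (yes _) = ≤-refl
  𝟙-≤1 (no _)  = 0≤fromℕ 1

  𝟙-0≤ : ∀ {P : Set} (P? : Dec P) → 0ℚ ≤ 𝟙 P?
  𝟙-0≤ (yes _) = 0≤fromℕ 1
  𝟙-0≤ (no _)  = ≤-refl

  𝟙-false : ∀ {P : Set} (P? : Dec P) → ¬ P → 𝟙 P? ≡ 0ℚ
  𝟙-false P? ¬p = cong (if_then 1ℚ else 0ℚ) (dec-false P? ¬p)

  𝟙-mono : ∀ {P Q : Set} (P? : Dec P) (Q? : Dec Q) → (P → Q) → 𝟙 P? ≤ 𝟙 Q?
  𝟙-mono (yes p) Q? P⇒Q = ≤-reflexive (sym (𝟙-true Q? (P⇒Q p)))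
  𝟙-mono (no _)  Q? P⇒Q = 𝟙-0≤ Q?

  -- Double counting. With `h` an indicator, it regroups a sum over arcs by endpoint, by item or by
  -- class.
  ∑ℚ-exchange : ∀ (xs : List A) (ys : List B) (g : B → ℚ) (h : B → A → ℚ) (f : A → ℚ) →
    ∑ℚ xs (λ x → ∑ℚ ys (λ y → g y * h y x) * f x) ≡ ∑ℚ ys (λ y → g y * ∑ℚ xs (λ x → h y x * f x))
  ∑ℚ-exchange xs ys g h f = begin
    ∑ℚ xs (λ x → ∑ℚ ys (λ y → g y * h y x) * f x)    ≡⟨ ∑ℚ-cong xs (λ {x} _ → sym (∑ℚ-*ʳ (f x) ys _)) ⟩
    ∑ℚ xs (λ x → ∑ℚ ys (λ y → g y * h y x * f x))    ≡⟨ ∑ℚ-swap xs ys _ ⟩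
    ∑ℚ ys (λ y → ∑ℚ xs (λ x → g y * h y x * f x))    ≡⟨ ∑ℚ-cong ys (λ {y} _ → trans
                                                          (∑ℚ-cong xs (λ {x} _ → *-assoc (g y) (h y x) (f x)))
                                                          (∑ℚ-*ˡ (g y) xs _)) ⟩
    ∑ℚ ys (λ y → g y * ∑ℚ xs (λ x → h y x * f x))    ∎
    where open ≡-Reasoning

  ∑ℚ-distrib : ∀ (xs : List A) (u v f : A → ℚ) →
    ∑ℚ xs (λ x → (u x + v x) * f x) ≡ ∑ℚ xs (λ x → u x * f x) + ∑ℚ xs (λ x → v x * f x)
  ∑ℚ-distrib xs u v f = trans (∑ℚ-cong xs (λ {x} _ → *-distribʳ-+ (f x) (u x) (v x))) (∑ℚ-+ xs _ _)

  -- The scheme of both potential arguments: `p` and `q` are a potential at the two ends of an arc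
  -- and `f` is the flow. Their totals agree by conservation and cancel from the sum of the
  -- inequalities on single arcs.
  ∑ℚ-cancel-≤ : ∀ (xs : List A) (p q g h f : A → ℚ) → (∀ {x} → x ∈ xs → 0ℚ ≤ f x) →
    ∑ℚ xs (λ x → p x * f x) ≡ ∑ℚ xs (λ x → q x * f x) →
    (∀ {x} → x ∈ xs → p x + g x ≤ q x + h x) →
    ∑ℚ xs (λ x → g x * f x) ≤ ∑ℚ xs (λ x → h x * f x)
  ∑ℚ-cancel-≤ xs p q g h f 0≤f p≡q le = +-cancelˡ-≤ (∑ℚ xs (λ x → p x * f x)) (begin
    ∑ℚ xs (λ x → p x * f x) + ∑ℚ xs (λ x → g x * f x)  ≡⟨ sym (∑ℚ-distrib xs p g f) ⟩
    ∑ℚ xs (λ x → (p x + g x) * f x)                    ≤⟨ ∑ℚ-mono xs (λ x∈ → *-monoʳ-≤-0≤ (0≤f x∈) (le x∈)) ⟩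
    ∑ℚ xs (λ x → (q x + h x) * f x)                    ≡⟨ ∑ℚ-distrib xs q h f ⟩
    ∑ℚ xs (λ x → q x * f x) + ∑ℚ xs (λ x → h x * f x)  ≡⟨ cong (_+ ∑ℚ xs (λ x → h x * f x)) (sym p≡q) ⟩
    ∑ℚ xs (λ x → p x * f x) + ∑ℚ xs (λ x → h x * f x)  ∎)
    where open ≤-Reasoning

-- Comparing two positions in a list without repetitions.

module Splits where
  open import Data.Nat using (_<_)
  open import Data.Nat.Properties using (m<m+n)

  -- Positions of x and y in a list that splits both as xs ++ x ∷ … and as
  -- ys ++ y ∷ …; earlier means that x precedes y.
  data SplitOrder {A : Set} (xs : List A) (x : A) (ys : List A) (y : A) : Set where
    same    : xs ≡ ys → x ≡ y → SplitOrder xs x ys y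
    earlier : ∀ mid → ys ≡ xs ++ x ∷ mid → x ≢ y → SplitOrder xs x ys y
    later   : ∀ mid → xs ≡ ys ++ y ∷ mid → x ≢ y → SplitOrder xs x ys y

  -- Compares the class or item of an arc with a fixed one, since stages are determined by
  -- positions. Uniqueness excludes that one element heads both splits at different positions.
  compareSplits : ∀ {A : Set} {zs : List A} → Unique zs → ∀ xs {x xs′} ys {y ys′} →
    zs ≡ xs ++ x ∷ xs′ → zs ≡ ys ++ y ∷ ys′ → SplitOrder xs x ys y
  compareSplits uniq     []       []       refl refl = same refl refl
  compareSplits (x∉ ∷ _) []       (_ ∷ ys) refl refl = earlier ys refl (All.lookup x∉ (∈-insert ys))
  compareSplits (y∉ ∷ _) (_ ∷ xs) []       refl refl = later xs refl (All.lookup y∉ (∈-insert xs) ∘ sym)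
  compareSplits (_ ∷ uniq) (_ ∷ xs) (_ ∷ ys) refl eq
    with refl ← ∷-injectiveˡ eq | compareSplits uniq xs ys refl (∷-injectiveʳ eq)
  ... | same refl x≡y        = same refl x≡y
  ... | earlier mid refl x≢y = earlier mid refl x≢y
  ... | later mid refl x≢y   = later mid refl x≢y

  length-prefix : ∀ {A : Set} (xs : List A) {y ys} → length xs < length (xs ++ y ∷ ys)
  length-prefix xs = subst (length xs <_) (sym (length-++ xs)) (m<m+n (length xs) (s≤s z≤n))

open Splits

-- Longest paths, and what trimming and merging preserve.

module Compression (I : BPPS) where
  open import Data.Nat using (_+_; _∸_; _≤_; _<_)
  open import Data.Nat.Properties hiding (_≟_)
  open DAG I

  module _ (G : Graph) where
    open Graph G

    infixr 5 _◅_

    -- The weight is an index so that a path corresponds to the membership of its weight in the list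
    -- enumerated by `weightsWithin`.
    data Path : Vertex → Vertex → ℕ → Set where
      ε   : ∀ {u} → Path u u 0
      _◅_ : ∀ {a v w} → a ∈ arcs → Path (head a) v w → Path (tail a) v (ω (type a) + w)

    IncreasingStages : Set
    IncreasingStages = ∀ {a} → a ∈ arcs → stage (tail a) < stage (head a)

    -- Dual feasibility for the longest path problem: along a path the inequalities telescope, so
    -- `β u` bounds the weight of every path from `u`.
    Capacity : (Vertex → ℕ) → Set
    Capacity β = ∀ {a} → a ∈ arcs → ω (type a) + β (head a) ≤ β (tail a)

  module _ {G : Graph} where
    open Graph G

    infixr 5 _◅◅_

    _◅◅_ : ∀ {u v x w w′} → Path G u v w → Path G v x w′ → Path G u x (w + w′)
    ε ◅◅ q = q
    _◅◅_ {w′ = w′} (_◅_ {a} {w = w} a∈ p) q =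
      subst (Path G _ _) (sym (+-assoc (ω (type a)) w w′)) (a∈ ◅ (p ◅◅ q))

    path-capacity : ∀ {β} → Capacity G β → ∀ {u v w} → Path G u v w → w + β v ≤ β u
    path-capacity cap ε = ≤-refl
    path-capacity {β} cap {v = v} (_◅_ {a} {w = w} a∈ p) = begin
      ω (type a) + w + β v     ≡⟨ +-assoc (ω (type a)) w (β v) ⟩
      ω (type a) + (w + β v)   ≤⟨ +-monoʳ-≤ (ω (type a)) (path-capacity cap p) ⟩
      ω (type a) + β (head a)  ≤⟨ cap a∈ ⟩
      β (tail a)               ∎
      where open ≤-Reasoning

    path-stage : IncreasingStages G → ∀ {u v w} → Path G u v w → stage u ≤ stage v
    path-stage inc ε        = ≤-refl
    path-stage inc (a∈ ◅ p) = ≤-trans (<⇒≤ (inc a∈)) (path-stage inc p)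

    weightsWithin⇒path : ∀ k {u v w} → w ∈ weightsWithin k u v → Path G u v w
    weightsWithin⇒path k {u} {v} w∈ with ∈-++⁻ (if does (u ≟ v) then [ 0 ] else []) w∈
    weightsWithin⇒path k {u} {v} w∈ | inj₁ w∈₀ with u ≟ v
    weightsWithin⇒path k {u} {v} w∈ | inj₁ (here refl) | yes refl = ε
    weightsWithin⇒path zero {u} {v} w∈ | inj₂ ()
    weightsWithin⇒path (suc k) {u} {v} w∈ | inj₂ w∈₊
      with a , a∈ , w∈ₐ ← find (∈-concatMap⁻ (λ a → map (ω (type a) +_) (weightsWithin k (head a) v)) {xs = arcs⁺ u} w∈₊)
      with w′ , w′∈ , refl ← ∈-map⁻ (ω (type a) +_) w∈ₐ
      with a∈′ , refl ← ∈-filter⁻ (λ a → tail a ≟ u) {xs = arcs} a∈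
      = a∈′ ◅ weightsWithin⇒path k w′∈

    -- Every arc consumes one unit of `k` and raises the stage by at least one, so `k` cannot run
    -- out before `v` is reached if it covers the difference of stages.
    path⇒weightsWithin : IncreasingStages G → ∀ k {u v w} → stage v ≤ k + stage u →
      Path G u v w → w ∈ weightsWithin k u v
    path⇒weightsWithin inc k {u} st ε rewrite dec-true (u ≟ u) refl = here refl
    path⇒weightsWithin inc zero st (a∈ ◅ p) =
      contradiction (≤-trans (<-≤-trans (inc a∈) (path-stage inc p)) st) (<-irrefl refl)
    path⇒weightsWithin inc (suc k) {u} {v} st (_◅_ {a} a∈ p) =
      ∈-++⁺ʳ (if does (u ≟ v) then [ 0 ] else [])
        (∈-concatMap⁺ (λ a → map (ω (type a) +_) (weightsWithin k (head a) v))
          (lose (∈-filter⁺ (λ a → tail a ≟ u) a∈ refl)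
            (∈-map⁺ (ω (type a) +_)
              (path⇒weightsWithin inc k
                (≤-trans st (≤-trans (≤-reflexive (sym (+-suc k (stage u)))) (+-monoʳ-≤ k (inc a∈))))
                p))))

    path⇒pathWeights : IncreasingStages G → ∀ {u v w} → stage v ≤ stage sink →
      Path G u v w → w ∈ pathWeights u v
    path⇒pathWeights inc {u} st = path⇒weightsWithin inc (stage sink) (≤-trans st (m≤m+n _ (stage u)))

    reaches⇒path : ∀ {u v} → Reaches u v → ∃ (Path G u v)
    reaches⇒path {u} {v} r with pathWeights u v in eq
    ... | w ∷ _ = w , weightsWithin⇒path (stage sink) (subst (w ∈_) (sym eq) (here refl))

    path⇒reaches : IncreasingStages G → ∀ {u w} → Path G u sink w → Reaches u sink
    path⇒reaches inc {u} p with pathWeights u sink | path⇒pathWeights inc ≤-refl p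
    ... | _ ∷ _ | _ = s≤s z≤n

    φ≤ : ∀ {u v b} → (∀ {w} → Path G u v w → w ≤ b) → φ u v ≤ b
    φ≤ {u} {v} bound = max≤v⁺ z≤n (All.tabulate λ w∈ → bound (weightsWithin⇒path (stage sink) w∈))

    ≤φ : IncreasingStages G → ∀ {u v w} → stage v ≤ stage sink → Path G u v w → w ≤ φ u v
    ≤φ inc {u} {v} st p = All.lookup (xs≤max 0 (pathWeights u v)) (path⇒pathWeights inc st p)

    φ-capacity : ∀ {β} → Capacity G β → ∀ u v → φ u v ≤ β u
    φ-capacity {β} cap u v = φ≤ λ p → ≤-trans (m≤m+n _ (β v)) (path-capacity cap p)

    -- Along a closed path the capacity returns to its initial value, which leaves room only for
    -- weight 0. This gives the source the second-step label 0.
    φ-diagonal : ∀ {β} → Capacity G β → ∀ u → φ u u ≡ 0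
    φ-diagonal {β} cap u = n≤0⇒n≡0 (φ≤ λ p → +-cancelʳ-≤ (β u) _ 0 (path-capacity cap p))

    module _ (inc : IncreasingStages G) {a : Arc Vertex} (a∈ : a ∈ arcs) where

      -- Bellman inequality: prefixing `a` turns a path from its head into a path from its tail. The
      -- given path excludes the default value 0 of `φ (head a) v`, for which the inequality could
      -- fail.
      φ-head : ∀ {v w} → stage v ≤ stage sink → Path G (head a) v w →
        ω (type a) + φ (head a) v ≤ φ (tail a) v
      φ-head {v} st p = subst (ωa + φ (head a) v ≤_) (m+[n∸m]≡n ωa≤)
        -- `φ≤` bounds only a bare `φ`, so the weight of `a` moves to the other side by a truncated
        -- subtraction, which is exact by `ωa≤`.
        (+-monoʳ-≤ ωa (φ≤ λ q → subst (_≤ φ (tail a) v ∸ ωa) (m+n∸m≡n ωa _) (∸-monoˡ-≤ ωa (≤φ inc st (a∈ ◅ q)))))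
        where
        ωa  = ω (type a)
        ωa≤ : ωa ≤ φ (tail a) v
        ωa≤ = ≤-trans (m≤m+n ωa _) (≤φ inc st (a∈ ◅ p))

      -- The mirror image, in which `a` is appended to paths ending in its tail.
      φ-tail : ∀ {u w} → stage (head a) ≤ stage sink → Path G u (tail a) w →
        φ u (tail a) + ω (type a) ≤ φ u (head a)
      φ-tail {u} st p = subst (φ u (tail a) + ωa ≤_) (m∸n+n≡m ωa≤)
        (+-monoˡ-≤ ωa (φ≤ λ {w} q → subst (_≤ φ u (head a) ∸ ωa) (m+n∸n≡m w ωa) (∸-monoˡ-≤ ωa (extend q))))
        where
        ωa  = ω (type a)
        extend : ∀ {w} → Path G u (tail a) w → w + ωa ≤ φ u (head a)
        extend {w} q = ≤φ inc st (subst (λ x → Path G u (head a) (w + x)) (+-identityʳ ωa) (q ◅◅ (a∈ ◅ ε)))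
        ωa≤ : ωa ≤ φ u (head a)
        ωa≤ = ≤-trans (m≤n+m ωa _) (extend p)

  module _ (G : Graph) (label : Graph.Vertex G → ℕ) where
    open Graph G

    key : Vertex → ℕ × ℕ
    key u = stage u , label u

    mergeArc : Arc Vertex → Arc (ℕ × ℕ)
    mergeArc a = arc (key (tail a)) (type a) (key (head a))

    ∈-merge⁻ : ∀ {b} → b ∈ Graph.arcs (merge G label) → ∃ λ a → a ∈ arcs × b ≡ mergeArc a
    ∈-merge⁻ b∈ = ∈-map⁻ mergeArc (∈-deduplicate⁻ (arc-≟ (Graph._≟_ (merge G label))) _ b∈)

    ∈-merge⁺ : ∀ {a} → a ∈ arcs → mergeArc a ∈ Graph.arcs (merge G label)
    ∈-merge⁺ a∈ = ∈-deduplicate⁺ (arc-≟ (Graph._≟_ (merge G label))) (∈-map⁺ mergeArc a∈)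

    merge-path : ∀ {u v w} → Path G u v w → Path (merge G label) (key u) (key v) w
    merge-path ε        = ε
    merge-path (a∈ ◅ p) = ∈-merge⁺ a∈ ◅ merge-path p

    merge-increasing : IncreasingStages G → IncreasingStages (merge G label)
    merge-increasing inc b∈ with _ , a∈ , refl ← ∈-merge⁻ b∈ = inc a∈

  module _ (G : Graph) where
    open Graph G

    private
      live? = λ a → reaches? (tail a) sink ×-dec reaches? (head a) sink

    ∈-trim⁻ : ∀ {a} → a ∈ Graph.arcs (trim G) → a ∈ arcs × Reaches (tail a) sink × Reaches (head a) sink
    ∈-trim⁻ = ∈-filter⁻ live? {xs = arcs}

    -- The continuation to the sink shows that every vertex on the path reaches the sink, so no arc
    -- of the path is removed.
    trim-path : IncreasingStages G → ∀ {u v w w′} → Path G u v w → Path G v sink w′ → Path (trim G) u v w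
    trim-path inc ε        q = ε
    trim-path inc (a∈ ◅ p) q =
      ∈-filter⁺ live? a∈ (path⇒reaches inc (a∈ ◅ (p ◅◅ q)) , path⇒reaches inc (p ◅◅ q)) ◅ trim-path inc p q

  module _ (G : Graph) where
    open Graph G

    private
      C = compress (trim G)
      module C = Graph C

    -- What is known of a compressed arc: type and stages are those of a raw arc, while the loads of
    -- its ends are replaced by second-step labels. `label-tail` admits any capacity of `G`, so the
    -- compression argument does not depend on how the raw DAG is built.
    record ArcOrigin (b : Arc C.Vertex) : Set where
      field
        origin     : Arc Vertex
        origin∈    : origin ∈ arcs
        same-type  : type b ≡ type origin
        same-tail  : C.stage (tail b) ≡ stage (tail origin)
        same-head  : C.stage (head b) ≡ stage (head origin)
        label-step : proj₂ (tail b) + ω (type b) ≤ proj₂ (head b)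
        label-tail : ∀ {β} → Capacity G β → proj₂ (tail b) ≤ β source

    module _ (inc : IncreasingStages G)
             (below : ∀ {a} → a ∈ arcs → stage (head a) ≤ stage sink)
             (reach : ∀ {a} → a ∈ arcs → ∃ (Path G source (tail a))) where

      private
        G₀ G₁ : Graph
        G₀ = trim G
        G₁ = compress₁ G₀

        label₁ : Vertex → ℕ
        label₁ u = Graph.φ G₀ u sink

        label₂ : ℕ × ℕ → ℕ
        label₂ = Graph.φ G₁ (Graph.source G₁)

        inc₀ : IncreasingStages G₀
        inc₀ a∈ = inc (proj₁ (∈-trim⁻ G a∈))

        inc₁ : IncreasingStages G₁
        inc₁ = merge-increasing G₀ label₁ inc₀

        -- A vertex of `G₁` carries as its second component the longest distance to the sink shared
        -- by its representatives, so the Bellman inequality of any arc of `G₀` passes to the merged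
        -- arc. It therefore also controls paths that exist only after merging.
        capacity₁ : Capacity G₁ proj₂
        capacity₁ b∈
          with a , a∈ , refl ← ∈-merge⁻ G₀ label₁ b∈
          with _ , _ , live ← ∈-trim⁻ G a∈
          = φ-head {G₀} inc₀ a∈ ≤-refl (trim-path G inc (proj₂ (reaches⇒path {G} live)) ε)

      compress-source : proj₂ C.source ≡ 0
      compress-source = φ-diagonal {G₁} {proj₂} capacity₁ (Graph.source G₁)

      compress-arc : ∀ {b} → b ∈ C.arcs → ArcOrigin b
      compress-arc b∈
        with b₁ , b₁∈ , refl ← ∈-merge⁻ G₁ label₂ b∈
        with a , a∈ , refl ← ∈-merge⁻ G₀ label₁ b₁∈
        with a∈′ , live , _ ← ∈-trim⁻ G a∈
        = record
        { origin     = a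
        ; origin∈    = a∈′
        ; same-type  = refl
        ; same-tail  = refl
        ; same-head  = refl
        -- `reach` gives a path from the source in `G`; it survives trimming because `live`
        -- continues it to the sink, and is then merged.
        ; label-step = φ-tail {G₁} inc₁ b₁∈ (below a∈′)
            (merge-path G₀ label₁ (trim-path G inc (proj₂ (reach a∈′)) (proj₂ (reaches⇒path {G} live))))
        -- The label of the tail is at most the first-step label of the source, which is the longest
        -- source-sink distance in `G₀`, and this is at most `β source`.
        ; label-tail = λ {β} cap → ≤-trans (φ-capacity {G₁} {proj₂} capacity₁ (Graph.source G₁) (tail b₁))
            (φ-capacity {G₀} {β} (λ a∈ → cap (proj₁ (∈-trim⁻ G a∈))) source sink)
        }

-- The shape, loads and stages of the arcs of the raw DAG.

module RawArcs (I : BPPS) (O : ProcessingOrder I) where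
  open import Data.Nat using (_+_; _∸_; _≤_; _<_; _≤?_)
  open import Data.Nat.Properties hiding (_≟_)
  open BPPS I
  open ProcessingOrder O
  open DAG I
  open Construction O
  open Compression I
  open Graph rawDAG using (arcs; source; sink)

  -- Loads and flags are left arbitrary: only the position of the item, which fixes the stage, and
  -- the fit into the bin are recorded. The stage is given by an equation so that it can be adjusted
  -- when the list is extended in front.
  data ItemsArc (is : List Item) (t : ℕ) : RawArc → Set where
    pass : ∀ {p i q ℓ s e} → is ≡ p ++ i ∷ q → s ≡ length p + t →
      ItemsArc is t (arc ⟨ ℓ , s , e ⟩ bypass ⟨ ℓ , suc s , e ⟩)
    take : ∀ {p i q ℓ s e} → is ≡ p ++ i ∷ q → s ≡ length p + t → ℓ + weight i ≤ d →
      ItemsArc is t (arc ⟨ ℓ , s , e ⟩ (item i) ⟨ ℓ + weight i , suc s , 1ℤ ⟩)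

  data ClassArc (c : Class) (t : ℕ) : RawArc → Set where
    skip   : ∀ {ℓ} → ClassArc c t (arc ⟨ ℓ , t , -1ℤ ⟩ bypass ⟨ ℓ , exitStage c t , -1ℤ ⟩)
    start  : ∀ {ℓ} → ℓ + setupWeight c ≤ d →
      ClassArc c t (arc ⟨ ℓ , t , -1ℤ ⟩ (setup c) ⟨ ℓ + setupWeight c , t + 1 , 0ℤ ⟩)
    inner  : ∀ {a} → ItemsArc (itemOrder c) (t + 1) a → ClassArc c t a
    finish : ∀ {ℓ} → ClassArc c t
      (arc ⟨ ℓ , t + length (itemOrder c) + 1 , 1ℤ ⟩ bypass ⟨ ℓ , exitStage c t , -1ℤ ⟩)

  data DAGArc : RawArc → Set where
    inClass : ∀ {a} pre {c post} → classOrder ≡ pre ++ c ∷ post → ClassArc c (finalStage pre 0) a → DAGArc a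
    final   : ∀ {ℓ} → DAGArc (arc ⟨ ℓ , finalStage classOrder 0 , -1ℤ ⟩ loss τ)

  finalStage-++ : ∀ cs ds t → finalStage (cs ++ ds) t ≡ finalStage ds (finalStage cs t)
  finalStage-++ []       ds t = refl
  finalStage-++ (c ∷ cs) ds t = finalStage-++ cs ds (exitStage c t)

  itemsArc-suc : ∀ {i is t a} → ItemsArc is (suc t) a → ItemsArc (i ∷ is) t a
  itemsArc-suc {i} {t = t} (pass {p} eq s≡)   = pass {p = i ∷ p} (cong (i ∷_) eq) (trans s≡ (+-suc (length p) t))
  itemsArc-suc {i} {t = t} (take {p} eq s≡ f) = take {p = i ∷ p} (cong (i ∷_) eq) (trans s≡ (+-suc (length p) t)) f

  ∈-fitting⁻ : ∀ w {L ℓ e} → (ℓ , e) ∈ fitting w L → (ℓ , e) ∈ L × ℓ + w ≤ d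
  ∈-fitting⁻ w {L} = ∈-filter⁻ (λ (ℓ , _) → ℓ + w ≤? d) {xs = L}

  ∈-itemsArcs : ∀ is t L {a} → a ∈ itemsArcs is t L → ItemsArc is t a
  ∈-itemsArcs (i ∷ is) t L a∈ with ∈-++⁻ (itemArcs i t L) a∈
  ... | inj₂ a∈is = itemsArc-suc (∈-itemsArcs is (suc t) (afterItem i L) a∈is)
  ... | inj₁ a∈i with ∈-++⁻ (map (λ (ℓ , e) → arc ⟨ ℓ , t , e ⟩ bypass ⟨ ℓ , suc t , e ⟩) L) a∈i
  ...   | inj₁ a∈b with _ , _ , refl ← ∈-map⁻ _ a∈b = pass {p = []} refl refl
  ...   | inj₂ a∈t with _ , ℓ∈ , refl ← ∈-map⁻ _ a∈t = take {p = []} refl refl (proj₂ (∈-fitting⁻ (weight i) {L} ℓ∈))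

  ∈-classArcs : ∀ c t E {a} → a ∈ classArcs c t E → ClassArc c t a
  ∈-classArcs c t E a∈ with ∈-++⁻ (map (λ ℓ → arc ⟨ ℓ , t , -1ℤ ⟩ bypass ⟨ ℓ , exitStage c t , -1ℤ ⟩) E) a∈
  ... | inj₁ a∈₁ with _ , _ , refl ← ∈-map⁻ _ a∈₁ = skip
  ... | inj₂ a∈′ with ∈-++⁻ (map (λ ℓ → arc ⟨ ℓ , t , -1ℤ ⟩ (setup c) ⟨ ℓ + setupWeight c , t + 1 , 0ℤ ⟩) (canSetup c E)) a∈′
  ...   | inj₁ a∈₂ with _ , ℓ∈ , refl ← ∈-map⁻ _ a∈₂ = start (proj₂ (∈-filter⁻ (λ ℓ → ℓ + setupWeight c ≤? d) {xs = E} ℓ∈))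
  ...   | inj₂ a∈″ with ∈-++⁻ (itemsArcs (itemOrder c) (t + 1) (afterSetup c E)) a∈″
  ...     | inj₁ a∈₃ = inner (∈-itemsArcs (itemOrder c) (t + 1) (afterSetup c E) a∈₃)
  ...     | inj₂ a∈₄ with _ , _ , refl ← ∈-map⁻ _ a∈₄ = finish

  ∈-allArcs : ∀ pre cs E {a} → classOrder ≡ pre ++ cs → a ∈ allArcs cs (finalStage pre 0) E → DAGArc a
  ∈-allArcs pre [] E eq a∈ with _ , _ , refl ← ∈-map⁻ _ a∈ =
    subst (λ t → DAGArc (arc ⟨ _ , t , -1ℤ ⟩ loss τ))
      (trans (cong (λ cs → finalStage cs 0) eq) (finalStage-++ pre [] 0)) final
  ∈-allArcs pre (c ∷ cs) E eq a∈ with ∈-++⁻ (classArcs c (finalStage pre 0) E) a∈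
  ... | inj₁ a∈c = inClass pre eq (∈-classArcs c _ E a∈c)
  ... | inj₂ a∈cs = ∈-allArcs (pre ++ [ c ]) cs (exitLayer c E) (trans eq (sym (++-assoc pre [ c ] cs)))
          (subst (λ t → _ ∈ allArcs cs t (exitLayer c E)) (sym (finalStage-++ pre [ c ] 0)) a∈cs)

  rawArc : ∀ {a} → a ∈ arcs → DAGArc a
  rawArc a∈ = ∈-allArcs [] classOrder [ 0 ] refl (∈-deduplicate⁻ (arc-≟ _≟ʳ_) (allArcs classOrder 0 [ 0 ]) a∈)

  -- The free space of the bin. It is a capacity of the raw DAG, and its value `d` at the source
  -- bounds the label of every tail in the compressed DAG.
  remaining : RawVertex → ℕ
  remaining ⟨ ℓ , _ , _ ⟩ = d ∸ ℓ
  remaining τ             = 0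

  pack-remaining : ∀ ℓ w → ℓ + w ≤ d → w + (d ∸ (ℓ + w)) ≤ d ∸ ℓ
  pack-remaining ℓ w fits = ≤-reflexive (trans (cong (w +_) (sym (∸-+-assoc d ℓ w)))
    (m+[n∸m]≡n (m+n≤o⇒m≤o∸n w (subst (_≤ d) (+-comm ℓ w) fits))))

  raw-capacity : Capacity rawDAG remaining
  raw-capacity a∈ with rawArc a∈
  ... | inClass _ _ skip                            = ≤-refl
  ... | inClass _ _ (start {ℓ} fits)                = pack-remaining ℓ _ fits
  ... | inClass _ _ (inner (pass _ _))              = ≤-refl
  ... | inClass _ _ (inner (take {ℓ = ℓ} _ _ fits)) = pack-remaining ℓ _ fits
  ... | inClass _ _ finish                          = ≤-refl
  ... | final                                       = z≤n

  exitStage-> : ∀ c t → t < exitStage c t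
  exitStage-> c t = subst (t <_) (sym (+-assoc t (length (itemOrder c)) 2))
    (m<m+n t (≤-trans (s≤s z≤n) (m≤n+m 2 (length (itemOrder c)))))

  finalStage-≥ : ∀ cs t → t ≤ finalStage cs t
  finalStage-≥ []       t = ≤-refl
  finalStage-≥ (c ∷ cs) t = ≤-trans (<⇒≤ (exitStage-> c t)) (finalStage-≥ cs (exitStage c t))

  itemStage-< : ∀ c t p {i q} → itemOrder c ≡ p ++ i ∷ q → suc (length p + (t + 1)) < exitStage c t
  itemStage-< c t p {i} {q} eq = begin-strict
    suc (length p + (t + 1))      ≡⟨ cong suc (trans (sym (+-assoc (length p) t 1)) (cong (_+ 1) (+-comm (length p) t))) ⟩
    suc (t + length p + 1)        ≡⟨ sym (+-suc (t + length p) 1) ⟩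
    t + length p + 2              <⟨ +-monoˡ-< 2 (+-monoʳ-< t (subst (λ is → length p < length is) (sym eq) (length-prefix p))) ⟩
    t + length (itemOrder c) + 2  ∎
    where open ≤-Reasoning

  classArc-tail : ∀ {c t a} → ClassArc c t a → t ≤ rawStage (tail a)
  classArc-tail skip = ≤-refl
  classArc-tail (start _) = ≤-refl
  classArc-tail {t = t} (inner (pass {p} _ refl)) = ≤-trans (m≤m+n t 1) (m≤n+m (t + 1) (length p))
  classArc-tail {t = t} (inner (take {p} _ refl _)) = ≤-trans (m≤m+n t 1) (m≤n+m (t + 1) (length p))
  classArc-tail {t = t} finish = ≤-trans (m≤m+n t _) (m≤m+n _ 1)

  classArc-head : ∀ {c t a} → ClassArc c t a → rawStage (head a) ≤ exitStage c t
  classArc-head skip = ≤-refl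
  classArc-head {c} {t} (start _) = subst (_≤ exitStage c t) (sym (+-comm t 1)) (exitStage-> c t)
  classArc-head {c} {t} (inner (pass {p} eq refl)) = <⇒≤ (itemStage-< c t p eq)
  classArc-head {c} {t} (inner (take {p} eq refl _)) = <⇒≤ (itemStage-< c t p eq)
  classArc-head finish = ≤-refl

  classArc-increasing : ∀ {c t a} → ClassArc c t a → rawStage (tail a) < rawStage (head a)
  classArc-increasing {c} {t} skip           = exitStage-> c t
  classArc-increasing {t = t} (start _)      = m<m+n t (s≤s z≤n)
  classArc-increasing (inner (pass _ _))     = n<1+n _
  classArc-increasing (inner (take _ _ _))   = n<1+n _
  classArc-increasing finish                 = +-monoʳ-< _ (s≤s (s≤s z≤n))

  raw-increasing : IncreasingStages rawDAG
  raw-increasing a∈ with rawArc a∈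
  ... | inClass _ _ a′ = classArc-increasing a′
  ... | final          = n<1+n _

  split-stages : ∀ pre {c mid} → exitStage c (finalStage pre 0) ≤ finalStage (pre ++ c ∷ mid) 0
  split-stages pre {c} {mid} = subst (exitStage c (finalStage pre 0) ≤_) (sym (finalStage-++ pre (c ∷ mid) 0))
    (finalStage-≥ mid (exitStage c (finalStage pre 0)))

  -- Only loss arcs end at the stage of the sink, where the load potential is reset to 0. The
  -- distinction is made by stage because stages survive compression.
  raw-head : ∀ {a} → a ∈ arcs → rawStage (head a) < rawStage τ ⊎ (rawStage (head a) ≡ rawStage τ × type a ≡ loss)
  raw-head a∈ with rawArc a∈
  ... | inClass pre {c} eq a′ = inj₁ (s≤s (≤-trans (classArc-head a′)
          (subst (λ cs → exitStage c (finalStage pre 0) ≤ finalStage cs 0) (sym eq) (split-stages pre))))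
  ... | final                 = inj₂ (refl , refl)

  raw-head-≤ : ∀ {a} → a ∈ arcs → rawStage (head a) ≤ rawStage τ
  raw-head-≤ a∈ = [ <⇒≤ , ≤-reflexive ∘ proj₁ ]′ (raw-head a∈)

  -- Every tail of a raw arc is reachable from the source.

  Reachable : RawVertex → Set
  Reachable v = ∃ (Path rawDAG source v)

  reach-head : ∀ {a} → a ∈ arcs → Reachable (tail a) → Reachable (head a)
  reach-head a∈ (_ , p) = _ , p ◅◅ (a∈ ◅ ε)

  Tails : List RawArc → Set
  Tails as = ∀ {a} → a ∈ as → Reachable (tail a)

  -- Paths use arcs of the whole DAG, so the induction over the construction carries along that the
  -- arcs generated from the current layer on belong to it.
  _⊆arcs : List RawArc → Set
  as ⊆arcs = ∀ {a} → a ∈ as → a ∈ arcs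

  ReachableLayer : ℕ → Layer → Set
  ReachableLayer t L = ∀ {ℓ e} → (ℓ , e) ∈ L → Reachable ⟨ ℓ , t , e ⟩

  ReachableEntry : ℕ → EntryLayer → Set
  ReachableEntry t E = ∀ {ℓ} → ℓ ∈ E → Reachable ⟨ ℓ , t , -1ℤ ⟩

  itemArcs-tails : ∀ i t L → ReachableLayer t L → Tails (itemArcs i t L)
  itemArcs-tails i t L reach a∈ with ∈-++⁻ (map (λ (ℓ , e) → arc ⟨ ℓ , t , e ⟩ bypass ⟨ ℓ , suc t , e ⟩) L) a∈
  ... | inj₁ a∈b with _ , ℓ∈ , refl ← ∈-map⁻ _ a∈b = reach ℓ∈
  ... | inj₂ a∈t with _ , ℓ∈ , refl ← ∈-map⁻ _ a∈t = reach (proj₁ (∈-fitting⁻ (weight i) {L} ℓ∈))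

  afterItem-reachable : ∀ i t L → itemArcs i t L ⊆arcs → ReachableLayer t L → ReachableLayer (suc t) (afterItem i L)
  afterItem-reachable i t L ⊆ reach ℓ∈ with ∈-++⁻ L (∈-deduplicate⁻ (Product.≡-dec ℕ._≟_ ℤ._≟_) (L ++ _) ℓ∈)
  ... | inj₁ ℓ∈L = reach-head (⊆ (∈-++⁺ˡ (∈-map⁺ _ ℓ∈L))) (reach ℓ∈L)
  ... | inj₂ ℓ∈t with _ , ℓ∈f , refl ← ∈-map⁻ _ ℓ∈t =
    reach-head (⊆ (∈-++⁺ʳ (map _ L) (∈-map⁺ _ ℓ∈f))) (reach (proj₁ (∈-fitting⁻ (weight i) {L} ℓ∈f)))

  itemsArcs-tails : ∀ is t L → itemsArcs is t L ⊆arcs → ReachableLayer t L → Tails (itemsArcs is t L)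
  itemsArcs-tails (i ∷ is) t L ⊆ reach a∈ with ∈-++⁻ (itemArcs i t L) a∈
  ... | inj₁ a∈i  = itemArcs-tails i t L reach a∈i
  ... | inj₂ a∈is = itemsArcs-tails is (suc t) (afterItem i L) (⊆ ∘ ∈-++⁺ʳ (itemArcs i t L))
          (afterItem-reachable i t L (⊆ ∘ ∈-++⁺ˡ) reach) a∈is

  afterItems-reachable : ∀ is t L → itemsArcs is t L ⊆arcs → ReachableLayer t L →
    ReachableLayer (length is + t) (afterItems is L)
  afterItems-reachable []       t L ⊆ reach ℓ∈ = reach ℓ∈
  afterItems-reachable (i ∷ is) t L ⊆ reach {ℓ} {e} ℓ∈ =
    subst (λ s → Reachable ⟨ ℓ , s , e ⟩) (+-suc (length is) t)
      (afterItems-reachable is (suc t) (afterItem i L) (⊆ ∘ ∈-++⁺ʳ (itemArcs i t L))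
        (afterItem-reachable i t L (⊆ ∘ ∈-++⁺ˡ) reach) ℓ∈)

  module _ (c : Class) (t : ℕ) (E : EntryLayer) (⊆ : classArcs c t E ⊆arcs) (reach : ReachableEntry t E) where

    private
      skips   = map (λ ℓ → arc ⟨ ℓ , t , -1ℤ ⟩ bypass ⟨ ℓ , exitStage c t , -1ℤ ⟩) E
      starts  = map (λ ℓ → arc ⟨ ℓ , t , -1ℤ ⟩ (setup c) ⟨ ℓ + setupWeight c , t + 1 , 0ℤ ⟩) (canSetup c E)
      inners  = itemsArcs (itemOrder c) (t + 1) (afterSetup c E)

      canSetup⊆ : ∀ {ℓ} → ℓ ∈ canSetup c E → ℓ ∈ E
      canSetup⊆ = proj₁ ∘ ∈-filter⁻ (λ ℓ → ℓ + setupWeight c ≤? d) {xs = E}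

      inners⊆ : inners ⊆arcs
      inners⊆ = ⊆ ∘ ∈-++⁺ʳ skips ∘ ∈-++⁺ʳ starts ∘ ∈-++⁺ˡ

      afterSetup-reachable : ReachableLayer (t + 1) (afterSetup c E)
      afterSetup-reachable ℓ∈
        with _ , ℓ∈c , refl ← ∈-map⁻ _ (∈-deduplicate⁻ (Product.≡-dec ℕ._≟_ ℤ._≟_) (map _ (canSetup c E)) ℓ∈)
        = reach-head (⊆ (∈-++⁺ʳ skips (∈-++⁺ˡ (∈-map⁺ _ ℓ∈c)))) (reach (canSetup⊆ ℓ∈c))

      packed-reachable : ∀ {ℓ} → ℓ ∈ packed c E → Reachable ⟨ ℓ , t + length (itemOrder c) + 1 , 1ℤ ⟩
      packed-reachable ℓ∈
        with (ℓ , e) , ℓ∈f , refl ← ∈-map⁻ proj₁ ℓ∈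
        with ℓ∈a , refl ← ∈-filter⁻ (λ (_ , e) → e ℤ.≟ 1ℤ) {xs = afterItems (itemOrder c) (afterSetup c E)} ℓ∈f
        = subst (λ s → Reachable ⟨ ℓ , s , 1ℤ ⟩)
            (trans (sym (+-assoc (length (itemOrder c)) t 1)) (cong (_+ 1) (+-comm (length (itemOrder c)) t)))
            (afterItems-reachable (itemOrder c) (t + 1) (afterSetup c E) inners⊆ afterSetup-reachable ℓ∈a)

    classArcs-tails : Tails (classArcs c t E)
    classArcs-tails a∈ with ∈-++⁻ skips a∈
    ... | inj₁ a∈₁ with _ , ℓ∈ , refl ← ∈-map⁻ _ a∈₁ = reach ℓ∈
    ... | inj₂ a∈′ with ∈-++⁻ starts a∈′
    ...   | inj₁ a∈₂ with _ , ℓ∈ , refl ← ∈-map⁻ _ a∈₂ = reach (canSetup⊆ ℓ∈)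
    ...   | inj₂ a∈″ with ∈-++⁻ inners a∈″
    ...     | inj₁ a∈₃ = itemsArcs-tails (itemOrder c) (t + 1) (afterSetup c E) inners⊆ afterSetup-reachable a∈₃
    ...     | inj₂ a∈₄ with _ , ℓ∈ , refl ← ∈-map⁻ _ a∈₄ = packed-reachable ℓ∈

    exitLayer-reachable : ReachableEntry (exitStage c t) (exitLayer c E)
    exitLayer-reachable ℓ∈ with ∈-++⁻ E (∈-deduplicate⁻ ℕ._≟_ (E ++ packed c E) ℓ∈)
    ... | inj₁ ℓ∈E = reach-head (⊆ (∈-++⁺ˡ (∈-map⁺ _ ℓ∈E))) (reach ℓ∈E)
    ... | inj₂ ℓ∈p = reach-head (⊆ (∈-++⁺ʳ skips (∈-++⁺ʳ starts (∈-++⁺ʳ inners (∈-map⁺ _ ℓ∈p))))) (packed-reachable ℓ∈p)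

  allArcs-tails : ∀ cs t E → allArcs cs t E ⊆arcs → ReachableEntry t E → Tails (allArcs cs t E)
  allArcs-tails []       t E ⊆ reach a∈ with _ , ℓ∈ , refl ← ∈-map⁻ _ a∈ = reach (proj₁ (∈-filter⁻ (1 ≤?_) {xs = E} ℓ∈))
  allArcs-tails (c ∷ cs) t E ⊆ reach a∈ with ∈-++⁻ (classArcs c t E) a∈
  ... | inj₁ a∈c  = classArcs-tails c t E (⊆ ∘ ∈-++⁺ˡ) reach a∈c
  ... | inj₂ a∈cs = allArcs-tails cs (exitStage c t) (exitLayer c E) (⊆ ∘ ∈-++⁺ʳ (classArcs c t E))
          (exitLayer-reachable c t E (⊆ ∘ ∈-++⁺ˡ) reach) a∈cs

  raw-reachable : ∀ {a} → a ∈ arcs → Reachable (tail a)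
  raw-reachable a∈ = allArcs-tails classOrder 0 [ 0 ] (∈-deduplicate⁺ (arc-≟ _≟ʳ_)) (λ { (here refl) → 0 , ε })
    (∈-deduplicate⁻ (arc-≟ _≟ʳ_) (allArcs classOrder 0 [ 0 ]) a∈)

  -- The interval of stages between the setup of a class and one of its items.

  classOrder-unique : Unique classOrder
  classOrder-unique = ↭ₛ.Unique-resp-↭ (setoid _) (↭⇒↭ₛ (↭-sym classes-↭)) (allFin⁺ m)

  itemOrder-unique : ∀ c → Unique (itemOrder c)
  itemOrder-unique c = ↭ₛ.Unique-resp-↭ (setoid _) (↭⇒↭ₛ (↭-sym (items-↭ c)))
    (filter⁺ (λ i → class i Fin.≟ c) (allFin⁺ n))

  ∈-itemOrder⁻ : ∀ {c i} → i ∈ itemOrder c → class i ≡ c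
  ∈-itemOrder⁻ {c} i∈ = proj₂ (∈-filter⁻ (λ i → class i Fin.≟ c) {xs = allFin n} (∈-resp-↭ (items-↭ c) i∈))

  ∈-itemOrder⁺ : ∀ i → i ∈ itemOrder (class i)
  ∈-itemOrder⁺ i = ∈-resp-↭ (↭-sym (items-↭ (class i))) (∈-filter⁺ (λ j → class j Fin.≟ class i) (∈-allFin i) refl)

  ∈-classOrder : ∀ c → c ∈ classOrder
  ∈-classOrder c = ∈-resp-↭ (↭-sym classes-↭) (∈-allFin c)

  module _ (i : Item) where

    private
      c = class i

      classSplit = ∈-∃++ (∈-classOrder c)
      pre        = proj₁ classSplit
      class≡     = proj₂ (proj₂ classSplit)

      itemSplit = ∈-∃++ (∈-itemOrder⁺ i)
      p         = proj₁ itemSplit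
      item≡     = proj₂ (proj₂ itemSplit)

      t = finalStage pre 0

    -- The stage at which setup arcs of `c` end and the stage at which item arcs of `i` start. In
    -- between lie bins that are set up for `c` and in which `i` is still undecided; the bypass of
    -- the whole class jumps over the interval.
    firstStage lastStage : ℕ
    firstStage = suc t
    lastStage  = length p + (t + 1)

    -- The indicator of this interval of stages is the first potential: it can
    -- only rise along setup arcs of c, and it drops along the item arcs of i.
    Inside : ℕ → Set
    Inside s = firstStage ≤ s × s ≤ lastStage

    -- `enters` says nothing about stages, since a setup arc pays for the largest possible rise of
    -- the indicator. `stays` is an implication from head to tail: the bypass of `i` may leave the
    -- interval, but no arc of this kind may enter it.
    data Crossing (a : RawArc) : Set where
      enters : type a ≡ setup c → Crossing a
      leaves : type a ≡ item i → Inside (rawStage (tail a)) → ¬ Inside (rawStage (head a)) → Crossing a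
      stays  : type a ≢ item i → (Inside (rawStage (head a)) → Inside (rawStage (tail a))) → Crossing a

    lastStage-< : suc lastStage < exitStage c t
    lastStage-< = itemStage-< c t p item≡

    source-outside : ¬ Inside 0
    source-outside (() , _)

    sink-outside : ¬ Inside (rawStage τ)
    sink-outside (_ , τ≤) = <⇒≱ (begin-strict
      lastStage                <⟨ <-trans (n<1+n _) lastStage-< ⟩
      exitStage c t            ≤⟨ split-stages pre ⟩
      finalStage (pre ++ c ∷ _) 0  ≡⟨ cong (λ cs → finalStage cs 0) (sym class≡) ⟩
      finalStage classOrder 0  <⟨ n<1+n _ ⟩
      rawStage τ               ∎) τ≤
      where open ≤-Reasoning

    private
      beyond : ∀ {A : Set} {s} → lastStage < s → Inside s → A
      beyond last<s (_ , s≤last) = contradiction s≤last (<⇒≱ last<s)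

      otherClass : ∀ {c′ t′ a} → ClassArc c′ t′ a → c ≢ c′ → type a ≢ item i
      otherClass skip                      c≢ ()
      otherClass (start _)                 c≢ ()
      otherClass (inner (pass _ _))        c≢ ()
      otherClass (inner (take {p} eq _ _)) c≢ refl = c≢ (∈-itemOrder⁻ (subst (i ∈_) (sym eq) (∈-insert p)))
      otherClass finish                    c≢ ()

      firstStage-≤ : ∀ l → firstStage ≤ l + (t + 1)
      firstStage-≤ l = subst (_≤ l + (t + 1)) (+-comm t 1) (m≤n+m (t + 1) l)

      beyond-item : ∀ mid {A : Set} → Inside (suc (length (p ++ i ∷ mid) + (t + 1))) → A
      beyond-item mid = beyond (m<n⇒m<1+n (+-monoˡ-< (t + 1) (length-prefix p)))

      before-item : ∀ p′ {j} mid → p ≡ p′ ++ j ∷ mid → Inside (length p′ + (t + 1))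
      before-item p′ {j} mid eq = firstStage-≤ (length p′) ,
        +-monoˡ-≤ (t + 1) (<⇒≤ (subst (λ is → length p′ < length is) (sym eq) (length-prefix p′)))

      -- Arcs at the position of `i` or later have their head beyond the interval; arcs at an
      -- earlier position have their tail inside it.
      itemsArc-crossing : ∀ {a} → ItemsArc (itemOrder c) (t + 1) a → Crossing a
      itemsArc-crossing (pass {p′} eq refl) with compareSplits (itemOrder-unique c) p p′ item≡ eq
      ... | same refl refl     = stays (λ ()) (beyond ≤-refl)
      ... | earlier mid refl _ = stays (λ ()) (beyond-item mid)
      ... | later mid eq′ _    = stays (λ ()) (λ _ → before-item p′ mid eq′)
      itemsArc-crossing (take {p′} eq refl _) with compareSplits (itemOrder-unique c) p p′ item≡ eq
      ... | same refl refl       = leaves refl (firstStage-≤ (length p) , ≤-refl) (beyond ≤-refl)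
      ... | earlier mid refl i≢j = stays (λ { refl → i≢j refl }) (beyond-item mid)
      ... | later mid eq′ i≢j    = stays (λ { refl → i≢j refl }) (λ _ → before-item p′ mid eq′)

      classArc-crossing : ∀ {a} → ClassArc c t a → Crossing a
      classArc-crossing skip       = stays (λ ()) (beyond (<-trans (n<1+n _) lastStage-<))
      classArc-crossing (start _)  = enters refl
      classArc-crossing (inner a′) = itemsArc-crossing a′
      classArc-crossing finish     = stays (λ ()) (beyond (<-trans (n<1+n _) lastStage-<))

    -- Arcs of another class have their head outside the interval: classes before `c` end at stage
    -- `t` at the latest, and classes after `c` start no earlier than the exit stage of `c`.
    raw-crossing : ∀ {a} → a ∈ arcs → Crossing a
    raw-crossing {a} a∈ with rawArc a∈
    ... | final = stays (λ ()) (λ in-τ → contradiction in-τ sink-outside)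
    ... | inClass pre′ {c′} eq a′ with compareSplits classOrder-unique pre pre′ class≡ eq
    ...   | same refl refl       = classArc-crossing a′
    ...   | earlier mid refl c≢c′ = stays (otherClass a′ c≢c′) (beyond (begin-strict
              lastStage              <⟨ <-trans (n<1+n _) lastStage-< ⟩
              exitStage c t          ≤⟨ split-stages pre ⟩
              finalStage pre′ 0      ≤⟨ classArc-tail a′ ⟩
              rawStage (tail a)      <⟨ classArc-increasing a′ ⟩
              rawStage (head a)      ∎))
      where open ≤-Reasoning
    ...   | later mid eq′ c≢c′   = stays (otherClass a′ c≢c′) λ { (first≤ , _) → contradiction first≤ (<⇒≱ (s≤s (begin
              rawStage (head a)               ≤⟨ classArc-head a′ ⟩
              exitStage c′ (finalStage pre′ 0) ≤⟨ split-stages pre′ ⟩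
              finalStage (pre′ ++ c′ ∷ mid) 0  ≡⟨ cong (λ cs → finalStage cs 0) (sym eq′) ⟩
              t                               ∎))) }
      where open ≤-Reasoning

-- Potentials on a flow, and arc weights and costs by type.

module Flows (I : BPPS) where
  open import Data.Rational hiding (_≟_)
  open import Data.Rational.Properties hiding (_≟_)
  open RationalSums
  open DAG I

  module _ (G : Graph) (f : Arc (Graph.Vertex G) → ℚ) where
    open Graph G

    private
      V : List Vertex
      V = deduplicate _≟_ vertices

    -- The value `π (end a)` is expanded by indicators over the vertices and the two sums are
    -- exchanged. The list `vertices` repeats endpoints, hence the deduplicated `V`.
    ∑-by-endpoint : (end : Arc Vertex → Vertex) → (∀ {a} → a ∈ arcs → end a ∈ vertices) → (π : Vertex → ℚ) →
      ∑ℚ arcs (λ a → π (end a) * f a) ≡ ∑ℚ V (λ v → π v * ∑ℚ (filter (λ a → end a ≟ v) arcs) f)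
    ∑-by-endpoint end end∈ π = begin
      ∑ℚ arcs (λ a → π (end a) * f a)
        ≡⟨ ∑ℚ-cong arcs (λ {a} a∈ → cong (_* f a) (sym (∑ℚ-𝟙 _≟_ π (UniqueDec.deduplicate-! _≟_ vertices) (∈-deduplicate⁺ _≟_ (end∈ a∈))))) ⟩
      ∑ℚ arcs (λ a → ∑ℚ V (λ v → π v * 𝟙 (end a ≟ v)) * f a)
        ≡⟨ ∑ℚ-exchange arcs V π (λ v a → 𝟙 (end a ≟ v)) f ⟩
      ∑ℚ V (λ v → π v * ∑ℚ arcs (λ a → 𝟙 (end a ≟ v) * f a))
        ≡⟨ ∑ℚ-cong V (λ {v} _ → cong (π v *_) (sym (∑ℚ-filter (λ a → end a ≟ v) arcs f))) ⟩
      ∑ℚ V (λ v → π v * ∑ℚ (filter (λ a → end a ≟ v) arcs) f)  ∎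
      where open ≡-Reasoning

    tail∈ : ∀ {a} → a ∈ arcs → tail a ∈ vertices
    tail∈ a∈ = there (there (∈-concatMap⁺ (λ a → tail a ∷ head a ∷ []) (lose a∈ (here refl))))

    head∈ : ∀ {a} → a ∈ arcs → head a ∈ vertices
    head∈ a∈ = there (there (∈-concatMap⁺ (λ a → tail a ∷ head a ∷ []) (lose a∈ (there (here refl)))))

    -- Summation by parts: at inner vertices inflow equals outflow, and at the source and the sink,
    -- where the constraints are silent, `π` is 0.
    circulation :
      (∀ v → v ∈ vertices → v ≢ source → v ≢ sink → ∑ℚ (arcs⁻ v) f - ∑ℚ (arcs⁺ v) f ≡ 0ℚ) →
      (π : Vertex → ℚ) → π source ≡ 0ℚ → π sink ≡ 0ℚ →
      ∑ℚ arcs (λ a → π (head a) * f a) ≡ ∑ℚ arcs (λ a → π (tail a) * f a)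
    circulation conservation π π-source π-sink = begin
      ∑ℚ arcs (λ a → π (head a) * f a)     ≡⟨ ∑-by-endpoint head head∈ π ⟩
      ∑ℚ V (λ v → π v * ∑ℚ (arcs⁻ v) f)    ≡⟨ ∑ℚ-cong V (λ {v} v∈ → balance v (∈-deduplicate⁻ _≟_ vertices v∈)) ⟩
      ∑ℚ V (λ v → π v * ∑ℚ (arcs⁺ v) f)    ≡⟨ sym (∑-by-endpoint tail tail∈ π) ⟩
      ∑ℚ arcs (λ a → π (tail a) * f a)     ∎
      where
      open ≡-Reasoning
      vanish : ∀ {v} p q → π v ≡ 0ℚ → π v * p ≡ π v * q
      vanish p q πv≡0 rewrite πv≡0 = trans (*-zeroˡ p) (sym (*-zeroˡ q))
      balance : ∀ v → v ∈ vertices → π v * ∑ℚ (arcs⁻ v) f ≡ π v * ∑ℚ (arcs⁺ v) f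
      balance v v∈ with v ≟ source | v ≟ sink
      ... | yes refl | _        = vanish _ _ π-source
      ... | no _     | yes refl = vanish _ _ π-sink
      ... | no v≢s   | no v≢t   = cong (π v *_) (p-q≡0⇒p≡q _ _ (conservation v v∈ v≢s v≢t))

  private
    ∑ℚ-*0 : ∀ {A : Set} (xs : List A) (g : A → ℚ) → ∑ℚ xs (λ x → g x * 0ℚ) ≡ 0ℚ
    ∑ℚ-*0 xs g = trans (∑ℚ-*ʳ 0ℚ xs g) (*-zeroʳ (∑ℚ xs g))

  open BPPS I

  -- An expansion in indicators with at most one nonzero summand, in the form that `∑ℚ-exchange`
  -- regroups by item.
  itemPart : ArcType → ℚ
  itemPart t = ∑ℚ (allFin n) (λ i → fromℕ (weight i) * 𝟙 (t ≟ᵗ item i))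

  setupPart : (Class → ℕ) → ArcType → ℚ
  setupPart g t = ∑ℚ (allFin m) (λ c → fromℕ (g c) * 𝟙 (t ≟ᵗ setup c))

  -- Comparing two item types or two setup types computes to comparing their indices, so `∑ℚ-𝟙`
  -- applies directly; all other indicators compute to 0.
  ω-by-type : ∀ t → fromℕ (ω t) ≡ itemPart t + setupPart setupWeight t
  ω-by-type (setup c) = sym (trans
    (cong₂ _+_ (∑ℚ-*0 (allFin n) (fromℕ ∘ weight)) (∑ℚ-𝟙 Fin._≟_ (fromℕ ∘ setupWeight) (allFin⁺ m) (∈-allFin c)))
    (+-identityˡ _))
  ω-by-type (item i) = sym (trans
    (cong₂ _+_ (∑ℚ-𝟙 Fin._≟_ (fromℕ ∘ weight) (allFin⁺ n) (∈-allFin i)) (∑ℚ-*0 (allFin m) (fromℕ ∘ setupWeight)))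
    (+-identityʳ _))
  ω-by-type bypass = sym (cong₂ _+_ (∑ℚ-*0 (allFin n) (fromℕ ∘ weight)) (∑ℚ-*0 (allFin m) (fromℕ ∘ setupWeight)))
  ω-by-type loss   = sym (cong₂ _+_ (∑ℚ-*0 (allFin n) (fromℕ ∘ weight)) (∑ℚ-*0 (allFin m) (fromℕ ∘ setupWeight)))

  arcCost-by-type : ∀ t → fromℕ (arcCost t) ≡ fromℕ r * 𝟙 (t ≟ᵗ loss) + setupPart setupCost t
  arcCost-by-type (setup c) = sym (trans
    (cong₂ _+_ (*-zeroʳ (fromℕ r)) (∑ℚ-𝟙 Fin._≟_ (fromℕ ∘ setupCost) (allFin⁺ m) (∈-allFin c)))
    (+-identityˡ _))
  arcCost-by-type (item i) = sym (cong₂ _+_ (*-zeroʳ (fromℕ r)) (∑ℚ-*0 (allFin m) (fromℕ ∘ setupCost)))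
  arcCost-by-type bypass   = sym (cong₂ _+_ (*-zeroʳ (fromℕ r)) (∑ℚ-*0 (allFin m) (fromℕ ∘ setupCost)))
  arcCost-by-type loss     = sym (trans
    (cong₂ _+_ (*-identityʳ (fromℕ r)) (∑ℚ-*0 (allFin m) (fromℕ ∘ setupCost)))
    (+-identityʳ _))

totalWeight totalSetupCost : BPPS → ℚ
totalWeight I    = ∑ℚ (allFin n) (fromℕ ∘ weight) ℚ.+ ∑ℚ (allFin m) (fromℕ ∘ setupWeight)
  where open BPPS I
totalSetupCost I = ∑ℚ (allFin m) (fromℕ ∘ setupCost)
  where open BPPS I

-- The lower bound on the cost of a feasible flow.

module ArcFlowBound (I : BPPS) (O : ProcessingOrder I)
  (f : ArcFlow.Flow I O) (feasible : ArcFlow.Feasible I O f) where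
  open import Data.Rational hiding (_≟_)
  open import Data.Rational.Properties hiding (_≟_)
  open RationalSums
  open BPPS I
  open DAG I
  open Construction O
  open Compression I
  open RawArcs I O
  open Flows I
  open ArcFlow I O using (objective)
  open ArcFlow.Feasible feasible
  open Graph compressedDAG

  amount : ArcType → ℚ
  amount t = ∑ℚ arcs (λ a → 𝟙 (type a ≟ᵗ t) * f a)

  amount-item : ∀ i → amount (item i) ≡ 1ℚ
  amount-item i = trans (sym (∑ℚ-filter (λ a → type a ≟ᵗ item i) arcs f)) (packing i)

  arcOrigin : ∀ {a} → a ∈ arcs → ArcOrigin rawDAG a
  arcOrigin = compress-arc rawDAG raw-increasing raw-head-≤ raw-reachable

  module _ (i : Item) where

    private
      inside? : ∀ s → Dec (Inside i s)
      inside? s = (firstStage i ℕ.≤? s) ×-dec (s ℕ.≤? lastStage i)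

      χ : Vertex → ℚ
      χ v = 𝟙 (inside? (stage v))

      -- The statement involves only types and stages, which a compressed arc shares with a raw arc,
      -- so the three kinds of crossing settle it.
      crossing-step : ∀ {a} → a ∈ arcs →
        χ (head a) + 𝟙 (type a ≟ᵗ item i) ≤ χ (tail a) + 𝟙 (type a ≟ᵗ setup (class i))
      crossing-step {arc u t v} a∈
        with record { origin∈ = a₀∈ ; same-type = refl ; same-tail = refl ; same-head = refl } ← arcOrigin a∈
        with raw-crossing i a₀∈
      ... | enters refl = begin
        χ v + 0ℚ                          ≡⟨ +-identityʳ (χ v) ⟩
        χ v                               ≤⟨ 𝟙-≤1 (inside? (stage v)) ⟩
        1ℚ                                ≡⟨ sym (𝟙-true (t ≟ᵗ setup (class i)) refl) ⟩
        𝟙 (t ≟ᵗ setup (class i))          ≤⟨ p≤q+p (𝟙-0≤ (inside? (stage u))) ⟩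
        χ u + 𝟙 (t ≟ᵗ setup (class i))    ∎
        where open ≤-Reasoning
      ... | leaves refl in-tail out-head = begin
        χ v + 𝟙 (t ≟ᵗ item i)             ≤⟨ +-monoʳ-≤ (χ v) (𝟙-≤1 (t ≟ᵗ item i)) ⟩
        χ v + 1ℚ                          ≡⟨ cong (_+ 1ℚ) (𝟙-false (inside? (stage v)) out-head) ⟩
        1ℚ                                ≡⟨ sym (𝟙-true (inside? (stage u)) in-tail) ⟩
        χ u                               ≡⟨ sym (+-identityʳ (χ u)) ⟩
        χ u + 0ℚ                          ∎
        where open ≤-Reasoning
      ... | stays t≢i back = begin
        χ v + 𝟙 (t ≟ᵗ item i)             ≡⟨ cong (χ v +_) (𝟙-false (t ≟ᵗ item i) t≢i) ⟩
        χ v + 0ℚ                          ≡⟨ +-identityʳ (χ v) ⟩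
        χ v                               ≤⟨ 𝟙-mono (inside? (stage v)) (inside? (stage u)) back ⟩
        χ u                               ≤⟨ p≤p+q (𝟙-0≤ (t ≟ᵗ setup (class i))) ⟩
        χ u + 𝟙 (t ≟ᵗ setup (class i))    ∎
        where open ≤-Reasoning

    setup-amount : 1ℚ ≤ amount (setup (class i))
    setup-amount = begin
      1ℚ                      ≡⟨ sym (amount-item i) ⟩
      amount (item i)         ≤⟨ ∑ℚ-cancel-≤ arcs (χ ∘ head) (χ ∘ tail) (λ a → 𝟙 (type a ≟ᵗ item i)) (λ a → 𝟙 (type a ≟ᵗ setup (class i))) f (λ {a} → nonnegative a)
                                   (circulation compressedDAG f conservation χ
                                     (𝟙-false (inside? 0) (source-outside i))
                                     (𝟙-false (inside? (rawStage τ)) (sink-outside i)))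
                                   crossing-step ⟩
      amount (setup (class i)) ∎
      where open ≤-Reasoning

  -- Zero at the sink, so that the conservation constraints suffice for the
  -- circulation identity; the drop is paid for by the term d of the loss arcs.
  potential : Vertex → ℕ
  potential v = if does (stage v ℕ.≟ rawStage τ) then 0 else proj₂ v

  potential-≤ : ∀ v → potential v ℕ.≤ proj₂ v
  potential-≤ v with does (stage v ℕ.≟ rawStage τ)
  ... | true  = ℕ.z≤n
  ... | false = ℕ.≤-refl

  potential-source : potential source ≡ 0
  potential-source = ℕ.n≤0⇒n≡0 (subst (potential source ℕ.≤_)
    (compress-source rawDAG raw-increasing raw-head-≤ raw-reachable) (potential-≤ source))

  potential-sink : potential sink ≡ 0
  potential-sink = cong (if_then 0 else proj₂ sink) (dec-true (rawStage τ ℕ.≟ rawStage τ) refl)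

  -- Away from the stage of the sink this is the growth of the labels. An arc into that stage is a
  -- loss arc: it has weight 0, the label of its tail is at most `d`, and the term `d` covers the
  -- reset.
  load-step : ∀ {a} → a ∈ arcs →
    fromℕ (potential (tail a)) + fromℕ (ω (type a)) ≤ fromℕ (potential (head a)) + fromℕ d * 𝟙 (type a ≟ᵗ loss)
  load-step {arc u t v} a∈
    with record { origin = a₀ ; origin∈ = a₀∈ ; same-type = refl ; same-tail = refl ; same-head = refl
                ; label-step = step ; label-tail = bounded } ← arcOrigin a∈
    with raw-head a₀∈
  ... | inj₁ below = begin
    fromℕ (potential u) + fromℕ (ω t)               ≡⟨ sym (fromℕ-homo-+ (potential u) (ω t)) ⟩
    fromℕ (potential u ℕ.+ ω t)                     ≤⟨ fromℕ-mono-≤ (ℕ.≤-trans (ℕ.+-monoˡ-≤ (ω t) (potential-≤ u)) step) ⟩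
    fromℕ (proj₂ v)                                 ≡⟨ cong fromℕ (sym (cong (if_then 0 else proj₂ v) (dec-false (stage v ℕ.≟ rawStage τ) (ℕ.<⇒≢ below)))) ⟩
    fromℕ (potential v)                             ≤⟨ p≤p+q (0≤* (0≤fromℕ d) (𝟙-0≤ (t ≟ᵗ loss))) ⟩
    fromℕ (potential v) + fromℕ d * 𝟙 (t ≟ᵗ loss)   ∎
    where open ≤-Reasoning
  ... | inj₂ (_ , refl) = begin
    fromℕ (potential u) + 0ℚ              ≡⟨ +-identityʳ _ ⟩
    fromℕ (potential u)                   ≤⟨ fromℕ-mono-≤ (ℕ.≤-trans (potential-≤ u) (bounded {remaining} raw-capacity)) ⟩
    fromℕ d                               ≡⟨ sym (*-identityʳ (fromℕ d)) ⟩
    fromℕ d * 1ℚ                          ≤⟨ p≤q+p (0≤fromℕ (potential v)) ⟩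
    fromℕ (potential v) + fromℕ d * 1ℚ    ∎
    where open ≤-Reasoning

  1≤setup-amount : ∀ c → 1ℚ ≤ amount (setup c)
  1≤setup-amount c with i , refl ← class-nonempty c = setup-amount i

  ∑-≤-setup-amount : ∀ (xs : List Class) (g : Class → ℕ) → ∑ℚ xs (fromℕ ∘ g) ≤ ∑ℚ xs (λ c → fromℕ (g c) * amount (setup c))
  ∑-≤-setup-amount xs g = ∑ℚ-mono xs λ {c} _ →
    subst (_≤ fromℕ (g c) * amount (setup c)) (*-identityʳ (fromℕ (g c))) (*-monoˡ-≤-0≤ (0≤fromℕ (g c)) (1≤setup-amount c))

  -- Items contribute with equality, as the packing constraints fix their amounts at 1; classes
  -- contribute an inequality, as a class may be set up in several bins.
  totalWeight-≤ : totalWeight I ≤ fromℕ d * amount loss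
  totalWeight-≤ = begin
    totalWeight I
      ≤⟨ +-mono-≤
           (≤-reflexive (∑ℚ-cong (allFin n) λ {i} _ → sym (trans (cong (fromℕ (weight i) *_) (amount-item i)) (*-identityʳ (fromℕ (weight i))))))
           (∑-≤-setup-amount (allFin m) setupWeight) ⟩
    ∑ℚ (allFin n) (λ i → fromℕ (weight i) * amount (item i)) + ∑ℚ (allFin m) (λ c → fromℕ (setupWeight c) * amount (setup c))
      ≡⟨ sym (cong₂ _+_
           (∑ℚ-exchange arcs (allFin n) (fromℕ ∘ weight) (λ i a → 𝟙 (type a ≟ᵗ item i)) f)
           (∑ℚ-exchange arcs (allFin m) (fromℕ ∘ setupWeight) (λ c a → 𝟙 (type a ≟ᵗ setup c)) f)) ⟩
    ∑ℚ arcs (λ a → itemPart (type a) * f a) + ∑ℚ arcs (λ a → setupPart setupWeight (type a) * f a)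
      ≡⟨ sym (∑ℚ-distrib arcs (itemPart ∘ type) (setupPart setupWeight ∘ type) f) ⟩
    ∑ℚ arcs (λ a → (itemPart (type a) + setupPart setupWeight (type a)) * f a)
      ≡⟨ ∑ℚ-cong arcs (λ {a} _ → cong (_* f a) (sym (ω-by-type (type a)))) ⟩
    ∑ℚ arcs (λ a → fromℕ (ω (type a)) * f a)
      ≤⟨ ∑ℚ-cancel-≤ arcs (fromℕ ∘ potential ∘ tail) (fromℕ ∘ potential ∘ head) _ _ f (λ {a} → nonnegative a)
           (sym (circulation compressedDAG f conservation (fromℕ ∘ potential) (cong fromℕ potential-source) (cong fromℕ potential-sink)))
           load-step ⟩
    ∑ℚ arcs (λ a → (fromℕ d * 𝟙 (type a ≟ᵗ loss)) * f a)
      ≡⟨ ∑ℚ-cong arcs (λ {a} _ → *-assoc (fromℕ d) (𝟙 (type a ≟ᵗ loss)) (f a)) ⟩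
    ∑ℚ arcs (λ a → fromℕ d * (𝟙 (type a ≟ᵗ loss) * f a))
      ≡⟨ ∑ℚ-*ˡ (fromℕ d) arcs _ ⟩
    fromℕ d * amount loss ∎
    where open ≤-Reasoning

  objective-≥ : fromℕ r * amount loss + totalSetupCost I ≤ objective f
  objective-≥ = begin
    fromℕ r * amount loss + totalSetupCost I
      ≤⟨ +-monoʳ-≤ (fromℕ r * amount loss) (∑-≤-setup-amount (allFin m) setupCost) ⟩
    fromℕ r * amount loss + ∑ℚ (allFin m) (λ c → fromℕ (setupCost c) * amount (setup c))
      ≡⟨ sym (cong₂ _+_
           (trans (∑ℚ-cong arcs (λ {a} _ → *-assoc (fromℕ r) (𝟙 (type a ≟ᵗ loss)) (f a))) (∑ℚ-*ˡ (fromℕ r) arcs _))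
           (∑ℚ-exchange arcs (allFin m) (fromℕ ∘ setupCost) (λ c a → 𝟙 (type a ≟ᵗ setup c)) f)) ⟩
    ∑ℚ arcs (λ a → (fromℕ r * 𝟙 (type a ≟ᵗ loss)) * f a) + ∑ℚ arcs (λ a → setupPart setupCost (type a) * f a)
      ≡⟨ sym (∑ℚ-distrib arcs (λ a → fromℕ r * 𝟙 (type a ≟ᵗ loss)) (setupPart setupCost ∘ type) f) ⟩
    ∑ℚ arcs (λ a → (fromℕ r * 𝟙 (type a ≟ᵗ loss) + setupPart setupCost (type a)) * f a)
      ≡⟨ ∑ℚ-cong arcs (λ {a} _ → cong (_* f a) (sym (arcCost-by-type (type a)))) ⟩
    objective f ∎
    where open ≤-Reasoning

-- The uniform solution of the natural relaxation.

module NaturalBound (I : BPPS) (k : ℕ) (1≤k : 1 ℕ.≤ k) where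
  open import Data.Rational hiding (_≟_)
  open import Data.Rational.Properties hiding (_≟_)
  open RationalSums
  open BPPS I
  open Natural I k

  module _ (v : Vars) (feasible : Feasible v) where
    open Vars v
    open Feasible feasible

    -- Sum the capacity constraints over the bins and use `z b ≤ 1`. Every item is assigned once in
    -- total, and by linking a class is set up at least as often as any one of its items is
    -- assigned.
    totalWeight-≤ : totalWeight I ≤ fromℕ d * fromℕ k
    totalWeight-≤ = begin
      totalWeight I
        ≤⟨ +-mono-≤ (weigh (allFin n) weight x (λ i → ≤-reflexive (sym (assignment i)))) (weigh (allFin m) setupWeight y 1≤∑y) ⟩
      ∑ℚ (allFin k) (λ b → ∑ℚ (allFin n) (λ i → fromℕ (weight i) * x i b)) + ∑ℚ (allFin k) (λ b → ∑ℚ (allFin m) (λ c → fromℕ (setupWeight c) * y c b))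
        ≡⟨ sym (∑ℚ-+ (allFin k) _ _) ⟩
      _ ≤⟨ ∑ℚ-mono (allFin k) (λ {b} _ → ≤-trans (capacity b) (*-monoˡ-≤-0≤ (0≤fromℕ d) (proj₂ (z-bounds b)))) ⟩
      ∑ℚ (allFin k) (λ b → fromℕ d * 1ℚ)
        ≡⟨ ∑ℚ-*ˡ (fromℕ d) (allFin k) (λ _ → 1ℚ) ⟩
      fromℕ d * ∑ℚ (allFin k) (λ b → 1ℚ)
        ≡⟨ cong (fromℕ d *_) (trans (∑ℚ-const-allFin k 1ℚ) (*-identityʳ (fromℕ k))) ⟩
      fromℕ d * fromℕ k ∎
      where
      open ≤-Reasoning
      1≤∑y : ∀ c → 1ℚ ≤ ∑ℚ (allFin k) (y c)
      1≤∑y c with i , refl ← class-nonempty c =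
        subst (_≤ ∑ℚ (allFin k) (y c)) (assignment i) (∑ℚ-mono (allFin k) λ {b} _ → linking c i b refl)
      weigh : ∀ {X : Set} (xs : List X) (g : X → ℕ) (h : X → Bin → ℚ) → (∀ j → 1ℚ ≤ ∑ℚ (allFin k) (h j)) →
        ∑ℚ xs (fromℕ ∘ g) ≤ ∑ℚ (allFin k) (λ b → ∑ℚ xs (λ j → fromℕ (g j) * h j b))
      weigh xs g h 1≤ = begin
        ∑ℚ xs (fromℕ ∘ g)
          ≤⟨ ∑ℚ-mono xs (λ {j} _ → subst (_≤ fromℕ (g j) * ∑ℚ (allFin k) (h j)) (*-identityʳ (fromℕ (g j))) (*-monoˡ-≤-0≤ (0≤fromℕ (g j)) (1≤ j))) ⟩
        ∑ℚ xs (λ j → fromℕ (g j) * ∑ℚ (allFin k) (h j))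
          ≡⟨ ∑ℚ-cong xs (λ {j} _ → sym (∑ℚ-*ˡ (fromℕ (g j)) (allFin k) (h j))) ⟩
        ∑ℚ xs (λ j → ∑ℚ (allFin k) (λ b → fromℕ (g j) * h j b))
          ≡⟨ ∑ℚ-swap xs (allFin k) _ ⟩
        ∑ℚ (allFin k) (λ b → ∑ℚ xs (λ j → fromℕ (g j) * h j b)) ∎

  -- The inverses are abstract rationals given with their defining equations, so that no division
  -- has to be unfolded.
  module Uniform (k⁻¹ d⁻¹ : ℚ) (0≤k⁻¹ : 0ℚ ≤ k⁻¹) (k*k⁻¹ : fromℕ k * k⁻¹ ≡ 1ℚ)
           (0≤d⁻¹ : 0ℚ ≤ d⁻¹) (d*d⁻¹ : fromℕ d * d⁻¹ ≡ 1ℚ) (W≤dk : totalWeight I ≤ fromℕ d * fromℕ k) where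

    private
      W F : ℚ
      W = totalWeight I
      F = totalSetupCost I

    -- The value of `z` makes every capacity constraint tight, the least that these `x` and `y`
    -- allow.
    uniform : Vars
    uniform = record { x = λ _ _ → k⁻¹ ; y = λ _ _ → k⁻¹ ; z = λ _ → W * d⁻¹ * k⁻¹ }

    k⁻¹-bounds : InUnitInterval k⁻¹
    k⁻¹-bounds = 0≤k⁻¹ , (begin
      k⁻¹            ≡⟨ sym (*-identityˡ k⁻¹) ⟩
      1ℚ * k⁻¹       ≤⟨ *-monoʳ-≤-0≤ 0≤k⁻¹ (fromℕ-mono-≤ {1} {k} 1≤k) ⟩
      fromℕ k * k⁻¹  ≡⟨ k*k⁻¹ ⟩
      1ℚ             ∎)
      where open ≤-Reasoning

    uniform-feasible : Feasible uniform
    uniform-feasible = record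
      { assignment = λ _ → trans (∑ℚ-const-allFin k k⁻¹) k*k⁻¹
      ; capacity   = λ _ → ≤-reflexive (begin
          ∑ℚ (allFin n) (λ i → fromℕ (weight i) * k⁻¹) + ∑ℚ (allFin m) (λ c → fromℕ (setupWeight c) * k⁻¹)
            ≡⟨ cong₂ _+_ (∑ℚ-*ʳ k⁻¹ (allFin n) (fromℕ ∘ weight)) (∑ℚ-*ʳ k⁻¹ (allFin m) (fromℕ ∘ setupWeight)) ⟩
          _                             ≡⟨ sym (*-distribʳ-+ k⁻¹ (∑ℚ (allFin n) (fromℕ ∘ weight)) _) ⟩
          W * k⁻¹                       ≡⟨ sym (*-identityˡ (W * k⁻¹)) ⟩
          1ℚ * (W * k⁻¹)                ≡⟨ cong (_* (W * k⁻¹)) (sym d*d⁻¹) ⟩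
          fromℕ d * d⁻¹ * (W * k⁻¹)     ≡⟨ rearrange (fromℕ d) d⁻¹ W k⁻¹ ⟩
          fromℕ d * (W * d⁻¹ * k⁻¹)     ∎)
      ; linking    = λ _ _ _ _ → ≤-refl
      ; x-bounds   = λ _ _ → k⁻¹-bounds
      ; y-bounds   = λ _ _ → k⁻¹-bounds
      ; z-bounds   = λ _ → 0≤* (0≤* 0≤W 0≤d⁻¹) 0≤k⁻¹ , subst (W * d⁻¹ * k⁻¹ ≤_) full
          (*-monoʳ-≤-0≤ 0≤k⁻¹ (*-monoʳ-≤-0≤ 0≤d⁻¹ W≤dk))
      }
      where
      open ≡-Reasoning
      open +-*-Solver
      0≤W : 0ℚ ≤ W
      0≤W = +-mono-≤ (0≤∑ℚ (allFin n) (0≤fromℕ ∘ weight)) (0≤∑ℚ (allFin m) (0≤fromℕ ∘ setupWeight))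
      rearrange : ∀ p q s t → p * q * (s * t) ≡ p * (s * q * t)
      rearrange = solve 4 (λ p q s t → p :* q :* (s :* t) := p :* (s :* q :* t)) refl
      regroup : ∀ p q s t → p * q * s * t ≡ p * s * (q * t)
      regroup = solve 4 (λ p q s t → p :* q :* s :* t := p :* s :* (q :* t)) refl
      full : fromℕ d * fromℕ k * d⁻¹ * k⁻¹ ≡ 1ℚ
      full = trans (regroup (fromℕ d) (fromℕ k) d⁻¹ k⁻¹) (cong₂ _*_ d*d⁻¹ k*k⁻¹)

    objective-uniform : objective uniform ≡ fromℕ r * (W * d⁻¹) + F
    objective-uniform = begin
      ∑ℚ (allFin k) (λ _ → fromℕ r * (W * d⁻¹ * k⁻¹) + ∑ℚ (allFin m) (λ c → fromℕ (setupCost c) * k⁻¹))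
        ≡⟨ ∑ℚ-const-allFin k _ ⟩
      fromℕ k * (fromℕ r * (W * d⁻¹ * k⁻¹) + ∑ℚ (allFin m) (λ c → fromℕ (setupCost c) * k⁻¹))
        ≡⟨ cong (λ q → fromℕ k * (fromℕ r * (W * d⁻¹ * k⁻¹) + q)) (∑ℚ-*ʳ k⁻¹ (allFin m) (fromℕ ∘ setupCost)) ⟩
      fromℕ k * (fromℕ r * (W * d⁻¹ * k⁻¹) + F * k⁻¹)
        ≡⟨ factor (fromℕ k) (fromℕ r) (W * d⁻¹) k⁻¹ F ⟩
      fromℕ k * k⁻¹ * (fromℕ r * (W * d⁻¹) + F)
        ≡⟨ cong (_* (fromℕ r * (W * d⁻¹) + F)) k*k⁻¹ ⟩
      1ℚ * (fromℕ r * (W * d⁻¹) + F)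
        ≡⟨ *-identityˡ _ ⟩
      fromℕ r * (W * d⁻¹) + F ∎
      where
      open ≡-Reasoning
      open +-*-Solver
      factor : ∀ p q s t u → p * (q * (s * t) + u * t) ≡ p * t * (q * s + u)
      factor = solve 5 (λ p q s t u → p :* (q :* (s :* t) :+ u :* t) := p :* t :* (q :* s :+ u)) refl

-- Comparison of the two optimal values.

open import Data.Nat using (_≤_)
open import Data.Rational using (_≥_)

proposition11 : (I : BPPS) (O : ProcessingOrder I)
    (k : ℕ) → 1 ≤ k → Packing.BoundsOptimalBins I k →
    (ζAF ζN : ℚ) → IsOptimalValue (LP-AF I O) ζAF → IsOptimalValue (LP-N I k) ζN →
    ζAF ≥ ζN
proposition11 I O k 1≤k _ ζAF ζN ((f , f-feasible , refl) , _) ((v , v-feasible , _) , ζN≤) = begin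
  ζN                                                        ≤⟨ ζN≤ uniform uniform-feasible ⟩
  Natural.objective I k uniform                             ≡⟨ objective-uniform ⟩
  fromℕ r ℚ.* (totalWeight I ℚ.* d⁻¹) ℚ.+ totalSetupCost I  ≤⟨ ℚ.+-monoˡ-≤ (totalSetupCost I) (*-monoˡ-≤-0≤ (0≤fromℕ r) W/d≤bins) ⟩
  fromℕ r ℚ.* amount loss ℚ.+ totalSetupCost I              ≤⟨ objective-≥ ⟩
  ArcFlow.objective I O f                                   ∎
  where
  open ℚ.≤-Reasoning
  open RationalSums
  open BPPS I using (d; r; d≥1)
  open DAG I using (loss)
  open ArcFlowBound I O f f-feasible using (amount; totalWeight-≤; objective-≥)
  module N = NaturalBound I k 1≤k

  k-inverse = fromℕ-inverse 1≤k
  k⁻¹       = proj₁ k-inverse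
  d-inverse = fromℕ-inverse d≥1
  d⁻¹       = proj₁ d-inverse
  0≤d⁻¹     = proj₁ (proj₂ d-inverse)
  d*d⁻¹     = proj₂ (proj₂ d-inverse)

  -- The optimal solution `v` of the natural relaxation enters through its feasibility, which bounds
  -- the total weight by `d` times `k`.
  open N.Uniform k⁻¹ d⁻¹ (proj₁ (proj₂ k-inverse)) (proj₂ (proj₂ k-inverse)) 0≤d⁻¹ d*d⁻¹ (N.totalWeight-≤ v v-feasible)

  W/d≤bins : totalWeight I ℚ.* d⁻¹ ℚ.≤ amount loss
  W/d≤bins = subst (totalWeight I ℚ.* d⁻¹ ℚ.≤_)
    (trans (swap (fromℕ d) (amount loss) d⁻¹) (trans (cong (ℚ._* amount loss) d*d⁻¹) (ℚ.*-identityˡ (amount loss))))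
    (*-monoʳ-≤-0≤ 0≤d⁻¹ totalWeight-≤)
    where
    open +-*-Solver
    swap : ∀ p q s → p ℚ.* q ℚ.* s ≡ p ℚ.* s ℚ.* q
    swap = solve 3 (λ p q s → p :* q :* s := p :* s :* q) refl
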